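{- Let $\mathcal T$ be a finite rooted binary tree, every internal node of which has exactly two children, with nonnegative edge weights $w$, with $m$ labelled leaves and total edge weight $W:=\sum_{e\in E(\mathcal T)}w(e)$. For every even $q$ with $2\le q\le m$ there exists a set $S$ of exactly $q$ leaves such that, with $p=q/m$, \[ w(J_{\mathcal T}(S))\ \ge\ \min\{p,\,2(1-p)\}\,W . \] Both branches of this bound are tight in general: for every rational $p\in(0,2/3]$ there are a finite rooted binary tree $\mathcal T$, every internal node of which has exactly two children, with nonnegative edge weights $w$, with $m$ labelled leaves and total edge weight $W=\sum_{e\in E(\mathcal T)}w(e)>0$, and an even $q$ with $2\le q\le m$ and $q/m=p$ such that the maximum of $w(J_{\mathcal T}(S))$ over all sets $S$ of exactly $q$ leaves equals $pW$; and for every rational $p\in[2/3,1]$ there are a finite rooted binary tree $\mathcal T$, every internal node of which has exactly two children, with nonnegative edge weights $w$, with $m$ labelled leaves and total edge weight $W=\sum_{e\in E(\mathcal T)}w(e)>0$, and an even $q$ with $2\le q\le m$ and $q/m=p$ such that the maximum of $w(J_{\mathcal T}(S))$ over all sets $S$ of exactly $q$ leaves equals $2(1-p)W$.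
   Context: For a tree $\mathcal T$ and an edge $e$, let $L_e$ be the set of leaves in the component of $\mathcal T-e$ not containing the root. For a set $S$ of leaves with $|S|$ even, $J_{\mathcal T}(S):=\{e\in E(\mathcal T): |L_e\cap S|\text{ is odd}\}$; this is the unique edge set of $\mathcal T$ in which the leaves of odd degree are exactly those of $S$ and all internal vertices have even degree. For $F\subseteq E(\mathcal T)$, $w(F):=\sum_{e\in F}w(e)$. The leaves of $\mathcal T$ are exactly its nodes without children. -}

module Defs where

open import Algebra.Bundles using (CommutativeRing)
open import Data.Fin.Subset using (Subset; ⊤; ⊥; _∩_; ∣_∣)
open import Data.Integer.Base using (ℤ; +_; -[1+_])
open import Data.List.Base using (List; []; _∷_; _++_; map; filter; foldr)
open import Data.Nat.Base as ℕ using (ℕ; suc; NonZero)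
open import Data.Nat.Divisibility using (_∣_; _∣?_)
open import Data.Product.Base using (_×_; ∃-syntax)
open import Data.Rational.Base using (ℚ; ↥_; ↧ₙ_)
import Data.Vec.Base as Vec
open import Level using (Level; 0ℓ; _⊔_) renaming (suc to lsuc)
open import Relation.Binary.Core using (Rel)
open import Relation.Binary.PropositionalEquality.Core using (_≡_)
open import Relation.Binary.Structures using (IsTotalOrder)
open import Relation.Nullary.Decidable using (¬?)
open import Relation.Nullary.Negation.Core using (¬_)
open import Relation.Unary using (Pred; Decidable)

-- Totally ordered fields, the setting for the edge weights.  The field of
-- real numbers is (classically) one of them.

record OrderedField c ℓ₁ ℓ₂ : Set (lsuc (c ⊔ ℓ₁ ⊔ ℓ₂)) where
  infix 4 _≤_ _<_
  infix 8 _⁻¹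
  field
    commutativeRing : CommutativeRing c ℓ₁

  open CommutativeRing commutativeRing public

  field
    _≤_          : Rel Carrier ℓ₂
    isTotalOrder : IsTotalOrder _≈_ _≤_
    +-mono-≤     : ∀ {x y u v} → x ≤ y → u ≤ v → x + u ≤ y + v
    *-nonNeg     : ∀ {x y} → 0# ≤ x → 0# ≤ y → 0# ≤ x * y
    0≉1          : ¬ 0# ≈ 1#
    -- The value of 0# ⁻¹ is unspecified.
    _⁻¹          : Carrier → Carrier
    ⁻¹-inverseʳ  : ∀ x → ¬ x ≈ 0# → x * x ⁻¹ ≈ 1#

  _<_ : Rel Carrier (ℓ₁ ⊔ ℓ₂)
  x < y = x ≤ y × ¬ x ≈ y

  open import Algebra.Properties.Semiring.Mult semiring public
    using () renaming (_×_ to _·_)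

  fromℤ : ℤ → Carrier
  fromℤ (+ n)    = n · 1#
  fromℤ -[1+ n ] = - (suc n · 1#)

  fromℚ : ℚ → Carrier
  fromℚ p = fromℤ (↥ p) * (↧ₙ p · 1#) ⁻¹

-- Finite rooted trees in which every internal node has exactly two children.
-- The left/right order of the children only serves to name the leaves.

data Tree : Set where
  leaf : Tree
  node : Tree → Tree → Tree

-- The leaves of t are labelled from left to right by Fin (#leaves t).

#leaves : Tree → ℕ
#leaves leaf       = 1
#leaves (node l r) = #leaves l ℕ.+ #leaves r

#leaves-nonZero : ∀ t → NonZero (#leaves t)
#leaves-nonZero leaf       = _
#leaves-nonZero (node l r) with #leaves l | #leaves-nonZero l
... | suc _ | _ = _

-- toˡ and toʳ join the root to its children; inˡ and inʳ are the edges of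
-- the two subtrees.

data Edge : Tree → Set where
  toˡ : ∀ {l r} → Edge (node l r)
  toʳ : ∀ {l r} → Edge (node l r)
  inˡ : ∀ {l r} → Edge l → Edge (node l r)
  inʳ : ∀ {l r} → Edge r → Edge (node l r)

edges : ∀ t → List (Edge t)
edges leaf       = []
edges (node l r) = toˡ ∷ toʳ ∷ map inˡ (edges l) ++ map inʳ (edges r)

-- The leaves in the component of t - e not containing the root, i.e. those of
-- the subtree hanging below e.

L : ∀ t → Edge t → Subset (#leaves t)
L (node l r) toˡ     = ⊤ {#leaves l} Vec.++ ⊥ {#leaves r}
L (node l r) toʳ     = ⊥ {#leaves l} Vec.++ ⊤ {#leaves r}
L (node l r) (inˡ e) = L l e Vec.++ ⊥ {#leaves r}
L (node l r) (inʳ e) = ⊥ {#leaves l} Vec.++ L r e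

J : ∀ t → Subset (#leaves t) → Pred (Edge t) 0ℓ
J t S e = ¬ 2 ∣ ∣ L t e ∩ S ∣

J? : ∀ t (S : Subset (#leaves t)) → Decidable (J t S)
J? t S e = ¬? (2 ∣? ∣ L t e ∩ S ∣)

module Weighted {c ℓ₁ ℓ₂} (K : OrderedField c ℓ₁ ℓ₂) where
  open OrderedField K

  record WeightedTree : Set (c ⊔ ℓ₂) where
    field
      tree   : Tree
      w      : Edge tree → Carrier
      nonNeg : ∀ e → 0# ≤ w e

    m : ℕ
    m = #leaves tree

    weight : ∀ {ℓ} {F : Pred (Edge tree) ℓ} → Decidable F → Carrier
    weight F? = foldr _+_ 0# (map w (filter F? (edges tree)))

    W : Carrier
    W = foldr _+_ 0# (map w (edges tree))

    MaxJWeight : ℕ → Carrier → Set (ℓ₁ ⊔ ℓ₂)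
    MaxJWeight q x =
      (∃[ S ] ∣ S ∣ ≡ q × weight (J? tree S) ≈ x) ×
      (∀ S → ∣ S ∣ ≡ q → weight (J? tree S) ≤ x)

{-# OPTIONS --safe #-}

-- The largest weight f(q) of a join J(S) with |S| = q is concave on even q: if |S| + 2 ≤ |T|,
-- then J(S) Δ J(T) contains a path between two leaves of T ∖ S, and switching it in both sets
-- keeps w(J(S)) + w(J(T)) and moves the sizes towards each other by 2. So f lies below a line
-- that touches it at q. A proper colouring of the edges with three colours (the two edges at
-- the root having the same colour) yields three even sets, the leaves without a given colour,
-- with 2m elements altogether; each edge is in exactly two of their joins, so the weights
-- sum to 2W. Hence the line is at least 2W/3 at 2m/3. It is nonnegative at 0, and at m if m is
-- even; for odd m averaging over all sets of m - 1 leaves shows that it is at least 2W/m at m - 1.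
-- These values imply the bound.
--
-- The bound is attained by unit weights on the edges above the m leaves, respectively above m/2
-- cherries, all other edges having weight 0.

module Submission where

open import Data.Fin.Subset using (Subset; ⊤; ⊥; _∩_; ∣_∣; inside; outside)
open import Data.Fin.Subset.Properties using (∣⊥∣≡0; ∣⊤∣≡n; ∣p∣≤n; ∩-identityˡ; ∩-zeroˡ)
open import Data.Integer.Base as ℤ using (+_; -[1+_]; +≤+)
import Data.Integer.Properties as ℤ
import Data.Integer.Solver as ℤ
open import Data.List.Base using (List; []; _∷_; _++_; map; filter; foldr; length)
open import Data.List.Properties using (length-map; length-++; filter-accept; filter-reject)
open import Data.List.Relation.Unary.All as All using (All; []; _∷_)
import Data.List.Relation.Unary.All.Properties as All
open import Data.Nat.Base as ℕ using (ℕ; zero; suc; z≤n; s≤s; NonZero)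
open import Data.Nat.Divisibility using (_∣_; _∣?_; divides; ∣m+n∣m⇒∣n; ∣-refl)
import Data.Nat.Properties as ℕ
import Data.Nat.Solver as ℕ
open import Data.Product.Base using (_×_; _,_; ∃-syntax; proj₁; proj₂)
open import Data.Rational.Base as ℚ using (ℚ; 0ℚ; 1ℚ; _/_; mkℚ; ↥_; ↧_; ↧ₙ_; toℚᵘ; *≤*; *<*)
import Data.Rational.Properties as ℚ
open import Data.Rational.Unnormalised.Base as ℚᵘ using (mkℚᵘ; *≡*)
import Data.Rational.Unnormalised.Properties as ℚᵘ
open import Data.Sum.Base using (_⊎_; inj₁; inj₂)
open import Data.Vec.Base as Vec using ([]; _∷_)
open import Data.Vec.Properties using (zipWith-++)
open import Defs
open import Function.Base using (_∘_)
open import Level using (_⊔_)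
open import Relation.Binary.Bundles using (Poset)
open import Relation.Binary.PropositionalEquality as ≡ using (_≡_)
import Relation.Binary.Reasoning.PartialOrder as PosetReasoning
import Relation.Binary.Reasoning.Setoid as SetoidReasoning
open import Relation.Binary.Structures using (IsTotalOrder)
open import Relation.Nullary.Decidable using (yes; no)
open import Relation.Nullary.Negation.Core using (¬_; contradiction)

-- Subsets joined at a node, and parity.

∣++∣ : ∀ {m n} (S : Subset m) (T : Subset n) → ∣ S Vec.++ T ∣ ≡ ∣ S ∣ ℕ.+ ∣ T ∣
∣++∣ []            T = ≡.refl
∣++∣ (inside  ∷ S) T = ≡.cong suc (∣++∣ S T)
∣++∣ (outside ∷ S) T = ∣++∣ S T

∣++∩++∣ : ∀ {m n} (P S : Subset m) (Q T : Subset n) →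
  ∣ (P Vec.++ Q) ∩ (S Vec.++ T) ∣ ≡ ∣ P ∩ S ∣ ℕ.+ ∣ Q ∩ T ∣
∣++∩++∣ P S Q T = ≡.trans (≡.cong ∣_∣ (zipWith-++ _ P Q S T)) (∣++∣ (P ∩ S) (Q ∩ T))

∣⊥∩∣ : ∀ {n} (S : Subset n) → ∣ ⊥ ∩ S ∣ ≡ 0
∣⊥∩∣ {n} S = ≡.trans (≡.cong ∣_∣ (∩-zeroˡ S)) (∣⊥∣≡0 n)

∣P++⊥∩∣ : ∀ {m n} (P S : Subset m) (T : Subset n) →
  ∣ (P Vec.++ ⊥) ∩ (S Vec.++ T) ∣ ≡ ∣ P ∩ S ∣
∣P++⊥∩∣ P S T = ≡.trans (∣++∩++∣ P S ⊥ T)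
  (≡.trans (≡.cong (∣ P ∩ S ∣ ℕ.+_) (∣⊥∩∣ T)) (ℕ.+-identityʳ _))

∣⊥++Q∩∣ : ∀ {m n} (S : Subset m) (Q T : Subset n) →
  ∣ (⊥ Vec.++ Q) ∩ (S Vec.++ T) ∣ ≡ ∣ Q ∩ T ∣
∣⊥++Q∩∣ S Q T = ≡.trans (∣++∩++∣ ⊥ S Q T) (≡.cong (ℕ._+ ∣ Q ∩ T ∣) (∣⊥∩∣ S))

⊤++⊤ : ∀ m {n} → ⊤ {m} Vec.++ ⊤ {n} ≡ ⊤ {m ℕ.+ n}
⊤++⊤ zero    = ≡.refl
⊤++⊤ (suc m) = ≡.cong (inside ∷_) (⊤++⊤ m)

#leaves≡suc : ∀ t → ∃[ n ] #leaves t ≡ suc n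
#leaves≡suc leaf = 0 , ≡.refl
#leaves≡suc (node l r) with #leaves≡suc l
... | n , eq = n ℕ.+ #leaves r , ≡.cong (ℕ._+ #leaves r) eq

-- The form `k * 2` agrees with the constructor `divides` and lets functions that recurse in steps
-- of two, such as `_⊙_`, compute by induction on `k`.
Even Odd : ℕ → Set
Even n = ∃[ k ] n ≡ k ℕ.* 2
Odd  n = ∃[ k ] n ≡ suc (k ℕ.* 2)

¬Even×Odd : ∀ {n} → Even n → ¬ Odd n
¬Even×Odd (zero  , ≡.refl) (_ , ())
¬Even×Odd (suc k , ≡.refl) (suc j , eq) =
  ¬Even×Odd (k , ≡.refl) (j , ℕ.suc-injective (ℕ.suc-injective eq))

even+even : ∀ {m n} → Even m → Even n → Even (m ℕ.+ n)
even+even (i , ≡.refl) (j , ≡.refl) = i ℕ.+ j , ≡.sym (ℕ.*-distribʳ-+ 2 i j)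

even+odd : ∀ {m n} → Even m → Odd n → Odd (m ℕ.+ n)
even+odd (i , ≡.refl) (j , ≡.refl) = i ℕ.+ j ,
  ≡.trans (ℕ.+-suc _ _) (≡.cong suc (≡.sym (ℕ.*-distribʳ-+ 2 i j)))

odd+even : ∀ {m n} → Odd m → Even n → Odd (m ℕ.+ n)
odd+even {m} {n} o e = ≡.subst Odd (ℕ.+-comm n m) (even+odd e o)

odd+odd : ∀ {m n} → Odd m → Odd n → Even (m ℕ.+ n)
odd+odd (i , ≡.refl) (j , ≡.refl) = suc (i ℕ.+ j) ,
  ≡.cong suc (≡.trans (ℕ.+-suc _ _) (≡.cong suc (≡.sym (ℕ.*-distribʳ-+ 2 i j))))

even⊎odd : ∀ n → Even n ⊎ Odd n
even⊎odd zero = inj₁ (0 , ≡.refl)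
even⊎odd (suc n) with even⊎odd n
... | inj₁ (k , ≡.refl) = inj₂ (k , ≡.refl)
... | inj₂ (k , ≡.refl) = inj₁ (suc k , ≡.refl)

-- Arithmetic in ordered fields.

module FieldProperties {c ℓ₁ ℓ₂} (K : OrderedField c ℓ₁ ℓ₂) where
  open OrderedField K
  open IsTotalOrder isTotalOrder public
    using (total; antisym; isPartialOrder)
    renaming (trans to ≤-trans; reflexive to ≤-reflexive; refl to ≤-refl)
  open import Algebra.Properties.Semiring.Mult semiring public
    using (×-homo-+; ×1-homo-*; ×-assoc-*; ×-congʳ)
  open import Algebra.Properties.Ring ring public
    using (-‿distribˡ-*; -‿involutive)

  poset : Poset c ℓ₁ ℓ₂
  poset = record { isPartialOrder = isPartialOrder }

  module ≤-Reasoning = PosetReasoning poset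
  module ≈-Reasoning = SetoidReasoning setoid

  open import Algebra.Solver.Ring.NaturalCoefficients.Default commutativeSemiring public
    using (solve; _:=_; _:+_; _:*_; con)

  +-monoˡ-≤ : ∀ x {y z} → y ≤ z → y + x ≤ z + x
  +-monoˡ-≤ x y≤z = +-mono-≤ y≤z ≤-refl

  +-monoʳ-≤ : ∀ x {y z} → y ≤ z → x + y ≤ x + z
  +-monoʳ-≤ x = +-mono-≤ ≤-refl

  +-cancelˡ-≤ : ∀ x {y z} → x + y ≤ x + z → y ≤ z
  +-cancelˡ-≤ x {y} {z} x+y≤x+z = begin
    y              ≈⟨ cancel y ⟨
    - x + (x + y)  ≤⟨ +-monoʳ-≤ (- x) x+y≤x+z ⟩
    - x + (x + z)  ≈⟨ cancel z ⟩
    z              ∎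
    where
    open ≤-Reasoning
    cancel : ∀ v → - x + (x + v) ≈ v
    cancel v = trans (sym (+-assoc (- x) x v)) (trans (+-congʳ (-‿inverseˡ x)) (+-identityˡ v))

  x+[y-x]≈y : ∀ x y → x + (y - x) ≈ y
  x+[y-x]≈y x y = trans (+-comm x (y - x)) (trans (+-assoc y (- x) x)
    (trans (+-congˡ (-‿inverseˡ x)) (+-identityʳ y)))

  x≤y⇒0≤y-x : ∀ {x y} → x ≤ y → 0# ≤ y - x
  x≤y⇒0≤y-x {x} {y} x≤y = +-cancelˡ-≤ x (begin
    x + 0#       ≈⟨ +-identityʳ x ⟩
    x            ≤⟨ x≤y ⟩
    y            ≈⟨ x+[y-x]≈y x y ⟨
    x + (y - x)  ∎)
    where open ≤-Reasoning

  *-monoʳ-≤ : ∀ a {x y} → 0# ≤ a → x ≤ y → a * x ≤ a * y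
  *-monoʳ-≤ a {x} {y} 0≤a x≤y = begin
    a * x                ≈⟨ +-identityʳ (a * x) ⟨
    a * x + 0#           ≤⟨ +-monoʳ-≤ (a * x) (*-nonNeg 0≤a (x≤y⇒0≤y-x x≤y)) ⟩
    a * x + a * (y - x)  ≈⟨ distribˡ a x (y - x) ⟨
    a * (x + (y - x))    ≈⟨ *-congˡ (x+[y-x]≈y x y) ⟩
    a * y                ∎
    where open ≤-Reasoning

  *-monoˡ-≤ : ∀ a {x y} → 0# ≤ a → x ≤ y → x * a ≤ y * a
  *-monoˡ-≤ a {x} {y} 0≤a x≤y = begin
    x * a ≈⟨ *-comm x a ⟩
    a * x ≤⟨ *-monoʳ-≤ a 0≤a x≤y ⟩
    a * y ≈⟨ *-comm a y ⟩
    y * a ∎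
    where open ≤-Reasoning

  *-cancelˡ-≈ : ∀ a {x y} → ¬ a ≈ 0# → a * x ≈ a * y → x ≈ y
  *-cancelˡ-≈ a {x} {y} a≉0 ax≈ay = trans (sym (cancel x)) (trans (*-congˡ ax≈ay) (cancel y))
    where
    cancel : ∀ v → a ⁻¹ * (a * v) ≈ v
    cancel v = trans (sym (*-assoc (a ⁻¹) a v))
      (trans (*-congʳ (trans (*-comm (a ⁻¹) a) (⁻¹-inverseʳ a a≉0))) (*-identityˡ v))

  -- By totality only `y ≤ x` needs an argument; then the two products are equal by antisymmetry,
  -- and `a` cancels from the equality.
  *-cancelˡ-≤ : ∀ a {x y} → 0# < a → a * x ≤ a * y → x ≤ y
  *-cancelˡ-≤ a {x} {y} (0≤a , 0≉a) ax≤ay with total x y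
  ... | inj₁ x≤y = x≤y
  ... | inj₂ y≤x = ≤-reflexive
    (*-cancelˡ-≈ a (0≉a ∘ sym) (antisym ax≤ay (*-monoʳ-≤ a 0≤a y≤x)))

  0≤1 : 0# ≤ 1#
  0≤1 with total 0# 1#
  ... | inj₁ 0≤1 = 0≤1
  -- If `1# ≤ 0#`, then `- 1#` is nonnegative, and hence so is its square `1#`.
  ... | inj₂ 1≤0 = begin
    0#                     ≤⟨ *-nonNeg 0≤-1 0≤-1 ⟩
    (0# - 1#) * (0# - 1#)  ≈⟨ *-cong (+-identityˡ (- 1#)) (+-identityˡ (- 1#)) ⟩
    - 1# * - 1#            ≈⟨ -‿distribˡ-* 1# (- 1#) ⟨
    - (1# * - 1#)          ≈⟨ -‿cong (*-identityˡ (- 1#)) ⟩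
    - - 1#                 ≈⟨ -‿involutive 1# ⟩
    1#                     ∎
    where
    open ≤-Reasoning
    0≤-1 = x≤y⇒0≤y-x 1≤0

  ⟦_⟧ : ℕ → Carrier
  ⟦ n ⟧ = n · 1#

  ⟦⟧-cong : ∀ {m n} → m ≡ n → ⟦ m ⟧ ≈ ⟦ n ⟧
  ⟦⟧-cong eq = reflexive (≡.cong ⟦_⟧ eq)

  ⟦1⟧≈1 : ⟦ 1 ⟧ ≈ 1#
  ⟦1⟧≈1 = +-identityʳ 1#

  ⟦⟧-homo-+ : ∀ m n → ⟦ m ℕ.+ n ⟧ ≈ ⟦ m ⟧ + ⟦ n ⟧
  ⟦⟧-homo-+ = ×-homo-+ 1#

  ⟦⟧-split : ∀ {m n} → m ℕ.≤ n → ⟦ n ⟧ ≈ ⟦ m ⟧ + ⟦ n ℕ.∸ m ⟧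
  ⟦⟧-split {m} {n} m≤n = trans (⟦⟧-cong (≡.sym (ℕ.m+[n∸m]≡n m≤n))) (⟦⟧-homo-+ m (n ℕ.∸ m))

  0≤⟦_⟧ : ∀ n → 0# ≤ ⟦ n ⟧
  0≤⟦ zero  ⟧ = ≤-refl
  0≤⟦ suc n ⟧ = begin
    0#          ≈⟨ +-identityˡ 0# ⟨
    0# + 0#     ≤⟨ +-mono-≤ 0≤1 0≤⟦ n ⟧ ⟩
    1# + ⟦ n ⟧  ∎
    where open ≤-Reasoning

  0<⟦suc_⟧ : ∀ n → 0# < ⟦ suc n ⟧
  0<⟦suc n ⟧ = 0≤⟦ suc n ⟧ , λ 0≈ → 0≉1 (antisym 0≤1 (begin
    1#          ≈⟨ +-identityʳ 1# ⟨
    1# + 0#     ≤⟨ +-monoʳ-≤ 1# 0≤⟦ n ⟧ ⟩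
    1# + ⟦ n ⟧  ≈⟨ 0≈ ⟨
    0#          ∎))
    where open ≤-Reasoning

  ⟦⟧-mono : ∀ {m n} → m ℕ.≤ n → ⟦ m ⟧ ≤ ⟦ n ⟧
  ⟦⟧-mono {n = n} z≤n = 0≤⟦ n ⟧
  ⟦⟧-mono (s≤s m≤n) = +-monoʳ-≤ 1# (⟦⟧-mono m≤n)

  -- An affine function of i that is nonnegative at a and at M/3 is nonnegative in between;
  -- the function is u + i (b - c), with the negative terms moved to the other side.
  affine-≤ : ∀ {a r M} u b c → a ℕ.≤ r → 3 ℕ.* r ℕ.≤ M →
    ⟦ a ⟧ * c ≤ u + ⟦ a ⟧ * b → ⟦ M ⟧ * c ≤ ⟦ 3 ⟧ * u + ⟦ M ⟧ * b →
    ⟦ r ⟧ * c ≤ u + ⟦ r ⟧ * b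
  affine-≤ {a} {r} {M} u b c a≤r 3r≤M at-a at-M with total c b
  -- The sign of the slope `b - c` decides which of the two given points bounds the value at `r`:
  -- the left one if the function increases, the right one otherwise.
  ... | inj₁ c≤b = begin
    ⟦ r ⟧ * c                    ≈⟨ split c ⟩
    ⟦ a ⟧ * c + d * c            ≤⟨ +-mono-≤ at-a (*-monoʳ-≤ d 0≤⟦ r ℕ.∸ a ⟧ c≤b) ⟩
    (u + ⟦ a ⟧ * b) + d * b      ≈⟨ +-assoc u _ _ ⟩
    u + (⟦ a ⟧ * b + d * b)      ≈⟨ +-congˡ (split b) ⟨
    u + ⟦ r ⟧ * b                ∎
    where
    open ≤-Reasoning
    d = ⟦ r ℕ.∸ a ⟧
    split : ∀ x → ⟦ r ⟧ * x ≈ ⟦ a ⟧ * x + d * x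
    split x = trans (*-congʳ (⟦⟧-split a≤r)) (distribʳ x ⟦ a ⟧ d)
  ... | inj₂ b≤c = *-cancelˡ-≤ ⟦ 3 ⟧ 0<⟦suc 2 ⟧ (+-cancelˡ-≤ (d * c) (begin
    d * c + ⟦ 3 ⟧ * (⟦ r ⟧ * c)          ≈⟨ +-comm _ _ ⟩
    ⟦ 3 ⟧ * (⟦ r ⟧ * c) + d * c          ≈⟨ split c ⟨
    ⟦ M ⟧ * c                            ≤⟨ at-M ⟩
    ⟦ 3 ⟧ * u + ⟦ M ⟧ * b                ≈⟨ +-congˡ (split b) ⟩
    ⟦ 3 ⟧ * u + (⟦ 3 ⟧ * (⟦ r ⟧ * b) + d * b)
      ≤⟨ +-monoʳ-≤ _ (+-monoʳ-≤ _ (*-monoʳ-≤ d 0≤⟦ M ℕ.∸ 3 ℕ.* r ⟧ b≤c)) ⟩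
    ⟦ 3 ⟧ * u + (⟦ 3 ⟧ * (⟦ r ⟧ * b) + d * c)
      ≈⟨ solve 4 (λ k u v w → k :* u :+ (k :* v :+ w) := w :+ k :* (u :+ v)) refl _ _ _ _ ⟩
    d * c + ⟦ 3 ⟧ * (u + ⟦ r ⟧ * b)      ∎))
    where
    open ≤-Reasoning
    d = ⟦ M ℕ.∸ 3 ℕ.* r ⟧
    split : ∀ x → ⟦ M ⟧ * x ≈ ⟦ 3 ⟧ * (⟦ r ⟧ * x) + d * x
    split x = trans (*-congʳ (⟦⟧-split 3r≤M)) (trans (distribʳ x _ d)
      (+-congʳ (trans (*-congʳ (×1-homo-* 3 r)) (*-assoc ⟦ 3 ⟧ ⟦ r ⟧ x))))

+-interchange : ∀ a b c d → (a ℕ.+ b) ℕ.+ (c ℕ.+ d) ≡ (a ℕ.+ c) ℕ.+ (b ℕ.+ d)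
+-interchange = solve 4 (λ a b c d → (a :+ b) :+ (c :+ d) := (a :+ c) :+ (b :+ d)) ≡.refl
  where open ℕ.+-*-Solver

-- Weights of joins by recursion on the tree, and the exchange of leaves.

module JoinWeight {c ℓ₁ ℓ₂} (K : OrderedField c ℓ₁ ℓ₂) where
  open OrderedField K
  open FieldProperties K
  open Weighted K

  infixr 8 _⊙_
  -- The contribution to the join of an edge of weight `x` with `n` chosen leaves below it. Through
  -- the recursion in steps of two, adding two leaves changes nothing definitionally.
  _⊙_ : ℕ → Carrier → Carrier
  0           ⊙ x = 0#
  1           ⊙ x = x
  suc (suc n) ⊙ x = n ⊙ x

  even⊙ : ∀ k x → (k ℕ.* 2) ⊙ x ≈ 0#
  even⊙ zero    x = refl
  even⊙ (suc k) x = even⊙ k x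

  odd⊙ : ∀ k x → suc (k ℕ.* 2) ⊙ x ≈ x
  odd⊙ zero    x = refl
  odd⊙ (suc k) x = odd⊙ k x

  ⊙-congˡ : ∀ {m n} x → m ≡ n → m ⊙ x ≈ n ⊙ x
  ⊙-congˡ x eq = reflexive (≡.cong (_⊙ x) eq)

  ⊙-nonNeg : ∀ n {x} → 0# ≤ x → 0# ≤ n ⊙ x
  ⊙-nonNeg 0             0≤x = ≤-refl
  ⊙-nonNeg 1             0≤x = 0≤x
  ⊙-nonNeg (suc (suc n)) 0≤x = ⊙-nonNeg n 0≤x

  2∣⇒⊙≈0 : ∀ n x → 2 ∣ n → n ⊙ x ≈ 0#
  2∣⇒⊙≈0 n x (divides k ≡.refl) = even⊙ k x

  2∤⇒⊙≈ : ∀ n x → ¬ 2 ∣ n → n ⊙ x ≈ x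
  2∤⇒⊙≈ n x 2∤n with even⊎odd n
  ... | inj₁ (k , eq)     = contradiction (divides k eq) 2∤n
  ... | inj₂ (k , ≡.refl) = odd⊙ k x

  ∑ : ∀ {a} {A : Set a} → (A → Carrier) → List A → Carrier
  ∑ f []       = 0#
  ∑ f (x ∷ xs) = f x + ∑ f xs

  ∑-++ : ∀ {a} {A : Set a} (f : A → Carrier) xs ys → ∑ f (xs ++ ys) ≈ ∑ f xs + ∑ f ys
  ∑-++ f []       ys = sym (+-identityˡ _)
  ∑-++ f (x ∷ xs) ys = trans (+-congˡ (∑-++ f xs ys)) (sym (+-assoc (f x) _ _))

  ∑-map : ∀ {a b} {A : Set a} {B : Set b} (f : B → Carrier) (g : A → B) xs →
    ∑ f (map g xs) ≡ ∑ (f ∘ g) xs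
  ∑-map f g []       = ≡.refl
  ∑-map f g (x ∷ xs) = ≡.cong₂ _+_ ≡.refl (∑-map f g xs)

  foldr-map≡∑ : ∀ {a} {A : Set a} (f : A → Carrier) xs → foldr _+_ 0# (map f xs) ≡ ∑ f xs
  foldr-map≡∑ f []       = ≡.refl
  foldr-map≡∑ f (x ∷ xs) = ≡.cong₂ _+_ ≡.refl (foldr-map≡∑ f xs)

  -- Replaces sums over the list `edges t`, so that sums split at the root by definition.
  ∑ᴱ : ∀ t → (Edge t → Carrier) → Carrier
  ∑ᴱ leaf       f = 0#
  ∑ᴱ (node l r) f = (f toˡ + f toʳ) + (∑ᴱ l (f ∘ inˡ) + ∑ᴱ r (f ∘ inʳ))

  ∑ᴱ-cong : ∀ t {f g : Edge t → Carrier} → (∀ e → f e ≈ g e) → ∑ᴱ t f ≈ ∑ᴱ t g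
  ∑ᴱ-cong leaf       f≈g = refl
  ∑ᴱ-cong (node l r) f≈g = +-cong (+-cong (f≈g toˡ) (f≈g toʳ))
    (+-cong (∑ᴱ-cong l (f≈g ∘ inˡ)) (∑ᴱ-cong r (f≈g ∘ inʳ)))

  ∑-edges : ∀ t (f : Edge t → Carrier) → ∑ f (edges t) ≈ ∑ᴱ t f
  ∑-edges leaf       f = refl
  ∑-edges (node l r) f = begin
    f toˡ + (f toʳ + ∑ f (map inˡ (edges l) ++ map inʳ (edges r)))
      ≈⟨ +-assoc _ _ _ ⟨
    f toˡ + f toʳ + ∑ f (map inˡ (edges l) ++ map inʳ (edges r))
      ≈⟨ +-congˡ (∑-++ f (map inˡ (edges l)) _) ⟩
    f toˡ + f toʳ + (∑ f (map inˡ (edges l)) + ∑ f (map inʳ (edges r)))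
      ≡⟨ ≡.cong₂ (λ x y → f toˡ + f toʳ + (x + y)) (∑-map f inˡ (edges l)) (∑-map f inʳ (edges r)) ⟩
    f toˡ + f toʳ + (∑ (f ∘ inˡ) (edges l) + ∑ (f ∘ inʳ) (edges r))
      ≈⟨ +-congˡ (+-cong (∑-edges l (f ∘ inˡ)) (∑-edges r (f ∘ inʳ))) ⟩
    f toˡ + f toʳ + (∑ᴱ l (f ∘ inˡ) + ∑ᴱ r (f ∘ inʳ)) ∎
    where open ≈-Reasoning

  module _ (t : Tree) (w : Edge t → Carrier) where
    w[J] : Subset (#leaves t) → Carrier
    w[J] S = ∑ᴱ t (λ e → ∣ L t e ∩ S ∣ ⊙ w e)

    w[E] : Carrier
    w[E] = ∑ᴱ t w

    w[J]-correct : ∀ S → foldr _+_ 0# (map w (filter (J? t S) (edges t))) ≈ w[J] S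
    w[J]-correct S = trans (reflexive (foldr-map≡∑ w (filter (J? t S) (edges t))))
      (trans (∑-filter (edges t)) (∑-edges t _))
      where
      ∑-filter : ∀ es → ∑ w (filter (J? t S) es) ≈ ∑ (λ e → ∣ L t e ∩ S ∣ ⊙ w e) es
      ∑-filter [] = refl
      ∑-filter (e ∷ es) with 2 ∣? ∣ L t e ∩ S ∣
      ... | yes 2∣n = trans
        (reflexive (≡.cong (∑ w) (filter-reject (J? t S) (λ 2∤n → 2∤n 2∣n))))
        (trans (∑-filter es) (trans (sym (+-identityˡ _)) (+-congʳ (sym (2∣⇒⊙≈0 _ (w e) 2∣n)))))
      ... | no  2∤n = trans
        (reflexive (≡.cong (∑ w) (filter-accept (J? t S) 2∤n)))
        (+-cong (sym (2∤⇒⊙≈ _ (w e) 2∤n)) (∑-filter es))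

    w[E]-correct : foldr _+_ 0# (map w (edges t)) ≈ w[E]
    w[E]-correct = trans (reflexive (foldr-map≡∑ w (edges t))) (∑-edges t w)

  0≤+ : ∀ {x y} → 0# ≤ x → 0# ≤ y → 0# ≤ x + y
  0≤+ 0≤x 0≤y = ≤-trans (≤-reflexive (sym (+-identityˡ 0#))) (+-mono-≤ 0≤x 0≤y)

  ∑ᴱ-nonNeg : ∀ t {f : Edge t → Carrier} → (∀ e → 0# ≤ f e) → 0# ≤ ∑ᴱ t f
  ∑ᴱ-nonNeg leaf       0≤f = ≤-refl
  ∑ᴱ-nonNeg (node l r) 0≤f = 0≤+ (0≤+ (0≤f toˡ) (0≤f toʳ))
    (0≤+ (∑ᴱ-nonNeg l (0≤f ∘ inˡ)) (∑ᴱ-nonNeg r (0≤f ∘ inʳ)))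

  w[J]-nonNeg : ∀ t w → (∀ e → 0# ≤ w e) → ∀ S → 0# ≤ w[J] t w S
  w[J]-nonNeg t w 0≤w S = ∑ᴱ-nonNeg t (λ e → ⊙-nonNeg ∣ L t e ∩ S ∣ (0≤w e))

  -- The basis of the inductions on the tree: outside of a subtree, the leaves chosen in it matter
  -- only through the parity of their number.
  w[J]-node : ∀ l r (w : Edge (node l r) → Carrier) S T → w[J] (node l r) w (S Vec.++ T) ≈
    (∣ S ∣ ⊙ w toˡ + ∣ T ∣ ⊙ w toʳ) + (w[J] l (w ∘ inˡ) S + w[J] r (w ∘ inʳ) T)
  w[J]-node l r w S T = +-cong
    (+-cong (⊙-congˡ (w toˡ) (≡.trans (∣P++⊥∩∣ ⊤ S T) (≡.cong ∣_∣ (∩-identityˡ S))))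
            (⊙-congˡ (w toʳ) (≡.trans (∣⊥++Q∩∣ S ⊤ T) (≡.cong ∣_∣ (∩-identityˡ T)))))
    (+-cong (∑ᴱ-cong l (λ e → ⊙-congˡ (w (inˡ e)) (∣P++⊥∩∣ (L l e) S T)))
            (∑ᴱ-cong r (λ e → ⊙-congˡ (w (inʳ e)) (∣⊥++Q∩∣ S (L r e) T))))

  -- The effect of switching paths that move `k` leaves from `T` to `S`. The field `parity` says
  -- that an edge above `t`, of any weight `x`, keeps its total contribution to the two joins, which
  -- is what the induction needs one level higher.
  record Exchange (k : ℕ) t (w : Edge t → Carrier) (S T : Subset (#leaves t)) : Set (c ⊔ ℓ₁) where
    constructor exch
    field
      {S′ T′} : Subset (#leaves t)
      ∣S′∣    : ∣ S′ ∣ ≡ k ℕ.+ ∣ S ∣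
      ∣T∣     : ∣ T ∣ ≡ k ℕ.+ ∣ T′ ∣
      w[J]≈   : w[J] t w S′ + w[J] t w T′ ≈ w[J] t w S + w[J] t w T
      parity  : ∀ x → ∣ S′ ∣ ⊙ x + ∣ T′ ∣ ⊙ x ≈ ∣ S ∣ ⊙ x + ∣ T ∣ ⊙ x

  exch₀ : ∀ {t w S T} → Exchange 0 t w S T
  exch₀ = exch ≡.refl ≡.refl refl (λ _ → refl)

  parity₂ : ∀ {a b a′ b′} → a′ ≡ 2 ℕ.+ a → b ≡ 2 ℕ.+ b′ →
    ∀ x → a′ ⊙ x + b′ ⊙ x ≈ a ⊙ x + b ⊙ x
  parity₂ ≡.refl ≡.refl x = refl

  parity₁ : ∀ {a b a′ b′} → b ≡ suc a → a′ ≡ suc a → b ≡ suc b′ →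
    ∀ x → a′ ⊙ x + b′ ⊙ x ≈ a ⊙ x + b ⊙ x
  parity₁ ≡.refl ≡.refl ≡.refl x = +-comm _ _

  -- The `parity` fields of the two parts take care of the edges at the root. The parity above the
  -- root is left to the caller, since sizes 1 and 2 need different arguments: in size 1 the two
  -- counts swap their parities, in size 2 each keeps its own.
  exch-node : ∀ i j {l r w S T S₂ T₂} → Exchange i l (w ∘ inˡ) S T → Exchange j r (w ∘ inʳ) S₂ T₂ →
    (∀ {a b} → a ≡ i ℕ.+ j ℕ.+ ∣ S Vec.++ S₂ ∣ → ∣ T Vec.++ T₂ ∣ ≡ i ℕ.+ j ℕ.+ b →
       ∀ x → a ⊙ x + b ⊙ x ≈ ∣ S Vec.++ S₂ ∣ ⊙ x + ∣ T Vec.++ T₂ ∣ ⊙ x) →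
    Exchange (i ℕ.+ j) (node l r) w (S Vec.++ S₂) (T Vec.++ T₂)
  exch-node i j {l} {r} {w} {S} {T} {S₂} {T₂} (exch {S′} {T′} s t e p)
      (exch {S₂′} {T₂′} s₂ t₂ e₂ p₂) par =
    exch {S′ = S′ Vec.++ S₂′} {T′ = T′ Vec.++ T₂′} size-S size-T eq (par size-S size-T)
    where
    size : ∀ {m n} (P P′ : Subset m) (Q Q′ : Subset n) →
      ∣ P′ ∣ ≡ i ℕ.+ ∣ P ∣ → ∣ Q′ ∣ ≡ j ℕ.+ ∣ Q ∣ →
      ∣ P′ Vec.++ Q′ ∣ ≡ i ℕ.+ j ℕ.+ ∣ P Vec.++ Q ∣
    size P P′ Q Q′ eq₁ eq₂ = ≡.trans (∣++∣ P′ Q′) (≡.trans (≡.cong₂ ℕ._+_ eq₁ eq₂)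
      (≡.trans (+-interchange i (∣ P ∣) j (∣ Q ∣)) (≡.cong (i ℕ.+ j ℕ.+_) (≡.sym (∣++∣ P Q)))))
    size-S = size S S′ S₂ S₂′ s s₂
    size-T = size T′ T T₂′ T₂ t t₂
    pair : ∀ P P₂ Q Q₂ → w[J] (node l r) w (P Vec.++ P₂) + w[J] (node l r) w (Q Vec.++ Q₂) ≈
      ((∣ P ∣ ⊙ w toˡ + ∣ Q ∣ ⊙ w toˡ) + (∣ P₂ ∣ ⊙ w toʳ + ∣ Q₂ ∣ ⊙ w toʳ)) +
      ((w[J] l (w ∘ inˡ) P + w[J] l (w ∘ inˡ) Q) + (w[J] r (w ∘ inʳ) P₂ + w[J] r (w ∘ inʳ) Q₂))
    pair P P₂ Q Q₂ = trans (+-cong (w[J]-node l r w P P₂) (w[J]-node l r w Q Q₂))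
      (solve 8 (λ a b c d a′ b′ c′ d′ → ((a :+ b) :+ (c :+ d)) :+ ((a′ :+ b′) :+ (c′ :+ d′)) :=
         ((a :+ a′) :+ (b :+ b′)) :+ ((c :+ c′) :+ (d :+ d′))) refl _ _ _ _ _ _ _ _)
    eq : w[J] (node l r) w (S′ Vec.++ S₂′) + w[J] (node l r) w (T′ Vec.++ T₂′) ≈
         w[J] (node l r) w (S Vec.++ S₂) + w[J] (node l r) w (T Vec.++ T₂)
    eq = trans (pair S′ S₂′ T′ T₂′) (trans (+-cong (+-cong (p (w toˡ)) (p₂ (w toʳ))) (+-cong e e₂))
      (sym (pair S S₂ T T₂)))

  -- The paths of J(S Δ T) pair up the leaves of S Δ T. Either one of them joins two leaves
  -- of T ∖ S, and switching it in both sets is an exchange of size 2, or there is at most one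
  -- more leaf in T ∖ S than in S ∖ T, and then the unpaired leaf is joined to the root.
  exchange : ∀ t (w : Edge t → Carrier) S T →
    Exchange 2 t w S T ⊎ ∣ T ∣ ℕ.≤ ∣ S ∣ ⊎ (∣ T ∣ ≡ suc ∣ S ∣ × Exchange 1 t w S T)
  exchange leaf w (outside ∷ []) (outside ∷ []) = inj₂ (inj₁ z≤n)
  exchange leaf w (inside  ∷ []) (outside ∷ []) = inj₂ (inj₁ z≤n)
  exchange leaf w (inside  ∷ []) (inside  ∷ []) = inj₂ (inj₁ (s≤s z≤n))
  exchange leaf w (outside ∷ []) (inside  ∷ []) =
    inj₂ (inj₂ (≡.refl , exch {S′ = inside ∷ []} {T′ = outside ∷ []} ≡.refl ≡.refl refl
      (λ x → +-comm x 0#)))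
  exchange (node l r) w S T with Vec.splitAt (#leaves l) S | Vec.splitAt (#leaves l) T
  ... | S₁ , S₂ , ≡.refl | T₁ , T₂ , ≡.refl
    with exchange l (w ∘ inˡ) S₁ T₁ | exchange r (w ∘ inʳ) S₂ T₂
  ... | inj₁ ex | _ = inj₁ (exch-node 2 0 ex exch₀ parity₂)
  ... | inj₂ _ | inj₁ ex = inj₁ (exch-node 0 2 {S = S₁} {T = T₁} exch₀ ex parity₂)
  -- The unpaired leaves of both subtrees are joined through the root.
  ... | inj₂ (inj₂ (_ , ex₁)) | inj₂ (inj₂ (_ , ex₂)) = inj₁ (exch-node 1 1 ex₁ ex₂ parity₂)
  ... | inj₂ (inj₁ T₁≤S₁) | inj₂ (inj₁ T₂≤S₂) = inj₂ (inj₁ (≡.subst₂ ℕ._≤_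
    (≡.sym (∣++∣ T₁ T₂)) (≡.sym (∣++∣ S₁ S₂)) (ℕ.+-mono-≤ T₁≤S₁ T₂≤S₂)))
  ... | inj₂ (inj₂ (eq , ex)) | inj₂ (inj₁ T₂≤S₂) with ℕ.m≤n⇒m<n∨m≡n T₂≤S₂
  -- The surplus of one leaf on the left is used up by a deficit on the right, or, in the next case
  -- of equal sizes there, survives as the surplus of the whole tree.
  ...   | inj₁ T₂<S₂ = inj₂ (inj₁ (≡.subst₂ ℕ._≤_ (≡.sym (∣++∣ T₁ T₂)) (≡.sym (∣++∣ S₁ S₂))
          (≡.subst (λ n → n ℕ.+ ∣ T₂ ∣ ℕ.≤ _) (≡.sym eq)
            (ℕ.≤-trans (ℕ.≤-reflexive (≡.sym (ℕ.+-suc ∣ S₁ ∣ ∣ T₂ ∣)))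
                (ℕ.+-monoʳ-≤ ∣ S₁ ∣ T₂<S₂)))))
  ...   | inj₂ T₂≡S₂ = inj₂ (inj₂ (∣T∣≡ , exch-node 1 0 {S₂ = S₂} {T₂ = T₂} ex exch₀
      (parity₁ ∣T∣≡)))
    where
    ∣T∣≡ : ∣ T₁ Vec.++ T₂ ∣ ≡ suc ∣ S₁ Vec.++ S₂ ∣
    ∣T∣≡ = ≡.trans (∣++∣ T₁ T₂) (≡.trans (≡.cong₂ ℕ._+_ eq T₂≡S₂) (≡.cong suc (≡.sym (∣++∣ S₁ S₂))))
  exchange (node l r) w _ _ | S₁ , S₂ , ≡.refl | T₁ , T₂ , ≡.refl
    | inj₂ (inj₁ T₁≤S₁) | inj₂ (inj₂ (eq , ex)) with ℕ.m≤n⇒m<n∨m≡n T₁≤S₁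
  ...   | inj₁ T₁<S₁ = inj₂ (inj₁ (≡.subst₂ ℕ._≤_ (≡.sym (∣++∣ T₁ T₂)) (≡.sym (∣++∣ S₁ S₂))
          (≡.subst (λ n → ∣ T₁ ∣ ℕ.+ n ℕ.≤ _) (≡.sym eq)
            (ℕ.≤-trans (ℕ.≤-reflexive (ℕ.+-suc ∣ T₁ ∣ ∣ S₂ ∣)) (ℕ.+-monoˡ-≤ ∣ S₂ ∣ T₁<S₁)))))
  ...   | inj₂ T₁≡S₁ = inj₂ (inj₂ (∣T∣≡ , exch-node 0 1 {S = S₁} {T = T₁} exch₀ ex (parity₁ ∣T∣≡)))
    where
    ∣T∣≡ : ∣ T₁ Vec.++ T₂ ∣ ≡ suc ∣ S₁ Vec.++ S₂ ∣
    ∣T∣≡ = ≡.trans (∣++∣ T₁ T₂) (≡.trans (≡.cong₂ ℕ._+_ T₁≡S₁ eq)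
      (≡.trans (ℕ.+-suc ∣ S₁ ∣ ∣ S₂ ∣) (≡.cong suc (≡.sym (∣++∣ S₁ S₂)))))

  exchange₂ : ∀ t (w : Edge t → Carrier) S T → 2 ℕ.+ ∣ S ∣ ℕ.≤ ∣ T ∣ → Exchange 2 t w S T
  exchange₂ t w S T S+2≤T with exchange t w S T
  ... | inj₁ ex = ex
  ... | inj₂ (inj₁ T≤S) = contradiction (ℕ.≤-trans S+2≤T T≤S)
      (ℕ.<-irrefl ≡.refl ∘ ℕ.<-trans (ℕ.n<1+n _))
  ... | inj₂ (inj₂ (T≡1+S , _)) = contradiction (≡.subst (2 ℕ.+ ∣ S ∣ ℕ.≤_) T≡1+S S+2≤T)
      (ℕ.<-irrefl ≡.refl)

-- Heaviest sets of given size and concavity.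

module Concavity {c ℓ₁ ℓ₂} (K : OrderedField c ℓ₁ ℓ₂) where
  open OrderedField K
  open FieldProperties K
  open JoinWeight K

  IsMax : ∀ {n} → (Subset n → Carrier) → ℕ → Subset n → Set ℓ₂
  IsMax f k S = ∀ T → ∣ T ∣ ≡ k → f T ≤ f S

  argmax : ∀ {n} (f : Subset n → Carrier) k → k ℕ.≤ n → ∃[ S ] ∣ S ∣ ≡ k × IsMax f k S
  argmax {zero} f .0 z≤n = [] , ≡.refl , λ { [] _ → ≤-refl }
  argmax {suc n} f zero _ with argmax (f ∘ (outside ∷_)) 0 z≤n
  ... | S , ∣S∣ , max = outside ∷ S , ∣S∣ , λ { (outside ∷ T) → max T }
  argmax {suc n} f (suc k) (s≤s k≤n)
    with argmax (f ∘ (inside ∷_)) k k≤n | ℕ.m≤n⇒m<n∨m≡n k≤n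
  -- For `k = n` no competing set omits the first element, so the comparison made below is void.
  ... | S , ∣S∣ , max | inj₂ ≡.refl = inside ∷ S , ≡.cong suc ∣S∣ , λ
    { (inside  ∷ T) ∣T∣ → max T (ℕ.suc-injective ∣T∣)
    ; (outside ∷ T) ∣T∣ → contradiction (≡.subst (ℕ._≤ n) ∣T∣ (∣p∣≤n T)) (ℕ.<-irrefl ≡.refl) }
  ... | S , ∣S∣ , max | inj₁ k<n with argmax (f ∘ (outside ∷_)) (suc k) k<n
  ...   | S′ , ∣S′∣ , max′ with total (f (inside ∷ S)) (f (outside ∷ S′))
  ...     | inj₁ le = outside ∷ S′ , ∣S′∣ , λ
    { (inside  ∷ T) ∣T∣ → ≤-trans (max T (ℕ.suc-injective ∣T∣)) le
    ; (outside ∷ T) ∣T∣ → max′ T ∣T∣ }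
  ...     | inj₂ ge = inside ∷ S , ≡.cong suc ∣S∣ , λ
    { (inside  ∷ T) ∣T∣ → max T (ℕ.suc-injective ∣T∣)
    ; (outside ∷ T) ∣T∣ → ≤-trans (max′ T ∣T∣) ge }

  -- The line passes through the maxima at the sizes `q` and `2 + q`. The size in the lower bound is
  -- `2 + q`, so `q = 0` is included.
  module SupportingLine (t : Tree) (w : Edge t → Carrier) (q : ℕ)
    (S⁻ : Subset (#leaves t)) (∣S⁻∣ : ∣ S⁻ ∣ ≡ q) (max⁻ : IsMax (w[J] t w) q S⁻)
    (S : Subset (#leaves t)) (∣S∣ : ∣ S ∣ ≡ 2 ℕ.+ q) (max : IsMax (w[J] t w) (2 ℕ.+ q) S)
    where

    private
      f = w[J] t w

    slope : Carrier
    slope = f S - f S⁻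

    f[S⁻]+slope : f S⁻ + slope ≈ f S
    f[S⁻]+slope = x+[y-x]≈y (f S⁻) (f S)

    -- An exchange between `S⁻` and `T` turns `S⁻` into a set of size `2 + q`, bounded by `max`, and
    -- makes `T` smaller by 2, so that the induction hypothesis applies.
    above : ∀ i T → ∣ T ∣ ≡ i ℕ.* 2 ℕ.+ (2 ℕ.+ q) → f T ≤ f S + ⟦ i ⟧ * slope
    above zero T ∣T∣ = begin
      f T             ≤⟨ max T ∣T∣ ⟩
      f S             ≈⟨ +-identityʳ (f S) ⟨
      f S + 0#        ≈⟨ +-congˡ (zeroˡ slope) ⟨
      f S + 0# * slope ∎
      where open ≤-Reasoning
    above (suc i) T ∣T∣ = +-cancelˡ-≤ (f S⁻) (begin
      f S⁻ + f T                           ≈⟨ w[J]≈ ⟨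
      f S′ + f T′
        ≤⟨ +-mono-≤ (max S′ (≡.trans ∣S′∣ (≡.cong (2 ℕ.+_) ∣S⁻∣)))
             (above i T′ (ℕ.+-cancelˡ-≡ 2 _ _ (≡.trans (≡.sym ∣T∣′) ∣T∣))) ⟩
      f S + (f S + ⟦ i ⟧ * slope)          ≈⟨ +-congʳ f[S⁻]+slope ⟨
      (f S⁻ + slope) + (f S + ⟦ i ⟧ * slope)
        ≈⟨ solve 4 (λ a s b i → (a :+ s) :+ (b :+ i :* s) := a :+ (b :+ (con 1 :+ i) :* s)) refl
            (f S⁻) slope (f S) ⟦ i ⟧ ⟩
      f S⁻ + (f S + ⟦ suc i ⟧ * slope)     ∎)
      where
      open ≤-Reasoning
      open Exchange (exchange₂ t w S⁻ T (≡.subst₂ ℕ._≤_ (≡.cong (2 ℕ.+_) (≡.sym ∣S⁻∣)) (≡.sym ∣T∣)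
        (ℕ.≤-trans (ℕ.m≤n+m (2 ℕ.+ q) (i ℕ.* 2)) (ℕ.m≤n+m _ 2)))) renaming (∣T∣ to ∣T∣′)

    -- Dual to `above`: an exchange between `T` and `S` takes `S` to size `q`, where `max⁻` applies,
    -- and makes `T` larger by 2.
    below : ∀ i T → i ℕ.* 2 ℕ.+ ∣ T ∣ ≡ q → f T + ⟦ i ⟧ * slope ≤ f S⁻
    below zero T ∣T∣ = begin
      f T + 0# * slope ≈⟨ trans (+-congˡ (zeroˡ slope)) (+-identityʳ (f T)) ⟩
      f T              ≤⟨ max⁻ T ∣T∣ ⟩
      f S⁻             ∎
      where open ≤-Reasoning
    below (suc i) T ∣T∣ = +-cancelˡ-≤ (f S⁻) (begin
      f S⁻ + (f T + ⟦ suc i ⟧ * slope)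
        ≈⟨ solve 4 (λ a s b i → a :+ (b :+ (con 1 :+ i) :* s) := (b :+ (a :+ s)) :+ i :* s) refl
            (f S⁻) slope (f T) ⟦ i ⟧ ⟩
      (f T + (f S⁻ + slope)) + ⟦ i ⟧ * slope ≈⟨ +-congʳ (+-congˡ f[S⁻]+slope) ⟩
      (f T + f S) + ⟦ i ⟧ * slope           ≈⟨ +-congʳ w[J]≈ ⟨
      (f S′ + f T′) + ⟦ i ⟧ * slope
        ≈⟨ solve 3 (λ a b c → (a :+ b) :+ c := b :+ (a :+ c)) refl (f S′) (f T′) _ ⟩
      f T′ + (f S′ + ⟦ i ⟧ * slope)
        ≤⟨ +-mono-≤ (max⁻ T′ (ℕ.+-cancelˡ-≡ 2 _ _ (≡.trans (≡.sym ∣T∣′) ∣S∣)))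
             (below i S′ size) ⟩
      f S⁻ + f S⁻                           ∎)
      where
      open ≤-Reasoning
      open Exchange (exchange₂ t w T S (≡.subst (2 ℕ.+ ∣ T ∣ ℕ.≤_) (≡.sym ∣S∣)
        (s≤s (s≤s (ℕ.≤-trans (ℕ.m≤n+m ∣ T ∣ (suc i ℕ.* 2)) (ℕ.≤-reflexive ∣T∣))))))
        renaming (∣T∣ to ∣T∣′)
      size : i ℕ.* 2 ℕ.+ ∣ S′ ∣ ≡ q
      size = ≡.trans (≡.cong (i ℕ.* 2 ℕ.+_) ∣S′∣)
        (≡.trans (ℕ.+-suc (i ℕ.* 2) _) (≡.trans (≡.cong suc (ℕ.+-suc (i ℕ.* 2) _)) ∣T∣))

    -- Twice the weights, since the slope is taken per two leaves.
    intercept : Carrier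
    intercept = ⟦ 2 ⟧ * f S - ⟦ 2 ℕ.+ q ⟧ * slope

    at-S : ⟦ 2 ⟧ * f S ≈ intercept + ⟦ 2 ℕ.+ q ⟧ * slope
    at-S = trans (sym (x+[y-x]≈y (⟦ 2 ℕ.+ q ⟧ * slope) _)) (+-comm _ intercept)

    -- Counted in pairs, `S` has size `suc h` and `T` has size `j`. Larger sets are handled by
    -- `above`, equal ones by `max` and smaller ones by `below`, where one more `slope` leads from
    -- `f S⁻` to `f S`.
    supporting-line : ∀ T → 2 ∣ q → 2 ∣ ∣ T ∣ → ⟦ 2 ⟧ * f T ≤ intercept + ⟦ ∣ T ∣ ⟧ * slope
    supporting-line T (divides h q≡) (divides j ∣T∣≡) = +-cancelˡ-≤ (⟦ 2 ℕ.+ q ⟧ * slope) (begin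
      ⟦ 2 ℕ.+ q ⟧ * slope + ⟦ 2 ⟧ * f T
        ≈⟨ +-congʳ (*-congʳ (trans (⟦⟧-cong (≡.cong (2 ℕ.+_) q≡)) (×1-homo-* (suc h) 2))) ⟩
      ⟦ suc h ⟧ * ⟦ 2 ⟧ * slope + ⟦ 2 ⟧ * f T
        ≈⟨ solve 4 (λ h k s a → h :* k :* s :+ k :* a := k :* (a :+ h :* s))
            refl ⟦ suc h ⟧ ⟦ 2 ⟧ slope (f T) ⟩
      ⟦ 2 ⟧ * (f T + ⟦ suc h ⟧ * slope)    ≤⟨ *-monoʳ-≤ ⟦ 2 ⟧ 0≤⟦ 2 ⟧ main ⟩
      ⟦ 2 ⟧ * (f S + ⟦ j ⟧ * slope)
        ≈⟨ solve 4 (λ j k s a → k :* (a :+ j :* s) := k :* a :+ j :* k :* s)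
            refl ⟦ j ⟧ ⟦ 2 ⟧ slope (f S) ⟩
      ⟦ 2 ⟧ * f S + ⟦ j ⟧ * ⟦ 2 ⟧ * slope
        ≈⟨ +-cong at-S (*-congʳ (trans (sym (×1-homo-* j 2)) (⟦⟧-cong (≡.sym ∣T∣≡)))) ⟩
      (intercept + ⟦ 2 ℕ.+ q ⟧ * slope) + ⟦ ∣ T ∣ ⟧ * slope
        ≈⟨ solve 3 (λ a b c → (a :+ b) :+ c := b :+ (a :+ c)) refl _ _ _ ⟩
      ⟦ 2 ℕ.+ q ⟧ * slope + (intercept + ⟦ ∣ T ∣ ⟧ * slope) ∎)
      where
      open ≤-Reasoning
      main : f T + ⟦ suc h ⟧ * slope ≤ f S + ⟦ j ⟧ * slope
      main with ℕ.≤-total (suc h) j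
      ... | inj₁ h<j = begin
        f T + ⟦ suc h ⟧ * slope ≤⟨ +-monoˡ-≤ _ (above i T size) ⟩
        (f S + ⟦ i ⟧ * slope) + ⟦ suc h ⟧ * slope
          ≈⟨ solve 4 (λ a i h s → (a :+ i :* s) :+ h :* s := a :+ (i :+ h) :* s) refl
              (f S) ⟦ i ⟧ ⟦ suc h ⟧ slope ⟩
        f S + (⟦ i ⟧ + ⟦ suc h ⟧) * slope
          ≈⟨ +-congˡ (*-congʳ (trans (sym (⟦⟧-homo-+ i (suc h))) (⟦⟧-cong (ℕ.m∸n+n≡m h<j)))) ⟩
        f S + ⟦ j ⟧ * slope ∎
        where
        i = j ℕ.∸ suc h
        size : ∣ T ∣ ≡ i ℕ.* 2 ℕ.+ (2 ℕ.+ q)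
        size = ≡.trans ∣T∣≡ (≡.trans (≡.cong (ℕ._* 2) (≡.sym (ℕ.m∸n+n≡m h<j)))
          (≡.trans (ℕ.*-distribʳ-+ 2 i (suc h)) (≡.cong (λ n → i ℕ.* 2 ℕ.+ (2 ℕ.+ n)) (≡.sym q≡))))
      ... | inj₂ j≤1+h with ℕ.m≤n⇒m<n∨m≡n j≤1+h
      ...   | inj₂ ≡.refl = +-monoˡ-≤ _ (max T (≡.trans ∣T∣≡ (≡.cong (2 ℕ.+_) (≡.sym q≡))))
      ...   | inj₁ (s≤s j≤h) = begin
        f T + ⟦ suc h ⟧ * slope
          ≈⟨ +-congˡ (*-congʳ (trans (⟦⟧-cong (≡.cong suc (≡.sym (ℕ.m∸n+n≡m j≤h))))
              (⟦⟧-homo-+ (suc i) j))) ⟩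
        f T + (⟦ suc i ⟧ + ⟦ j ⟧) * slope
          ≈⟨ solve 4 (λ a i j s → a :+ ((con 1 :+ i) :+ j) :* s :=
              ((a :+ i :* s) :+ s) :+ j :* s) refl (f T) ⟦ i ⟧ ⟦ j ⟧ slope ⟩
        ((f T + ⟦ i ⟧ * slope) + slope) + ⟦ j ⟧ * slope
          ≤⟨ +-monoˡ-≤ _ (+-monoˡ-≤ slope (below i T size)) ⟩
        (f S⁻ + slope) + ⟦ j ⟧ * slope ≈⟨ +-congʳ f[S⁻]+slope ⟩
        f S + ⟦ j ⟧ * slope ∎
        where
        i = h ℕ.∸ j
        size : i ℕ.* 2 ℕ.+ ∣ T ∣ ≡ q
        size = ≡.trans (≡.cong (i ℕ.* 2 ℕ.+_) ∣T∣≡) (≡.trans (≡.sym (ℕ.*-distribʳ-+ 2 i j))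
          (≡.trans (≡.cong (ℕ._* 2) (ℕ.m∸n+n≡m j≤h)) (≡.sym q≡)))

-- Families of leaf sets: all leaves but one, and the sets from a three-colouring.

coSingletons : ∀ t → List (Subset (#leaves t))
coSingletons leaf       = ⊥ ∷ []
coSingletons (node l r) = map (Vec._++ ⊤) (coSingletons l) ++ map (⊤ Vec.++_) (coSingletons r)

length-coSingletons : ∀ t → length (coSingletons t) ≡ #leaves t
length-coSingletons leaf = ≡.refl
length-coSingletons (node l r) = ≡.trans (length-++ (map (Vec._++ ⊤) (coSingletons l)))
  (≡.cong₂ ℕ._+_ (≡.trans (length-map _ (coSingletons l)) (length-coSingletons l))
                 (≡.trans (length-map _ (coSingletons r)) (length-coSingletons r)))

∣coSingletons∣ : ∀ t → All (λ S → suc ∣ S ∣ ≡ #leaves t) (coSingletons t)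
∣coSingletons∣ leaf = ≡.refl ∷ []
∣coSingletons∣ (node l r) = All.++⁺
  (All.map⁺ (All.map (λ {S} eq → ≡.trans (≡.cong suc (∣++∣ S ⊤))
    (≡.cong₂ ℕ._+_ eq (∣⊤∣≡n (#leaves r)))) (∣coSingletons∣ l)))
  (All.map⁺ (All.map (λ {S} eq → ≡.trans (≡.cong suc (∣++∣ (⊤ {#leaves l}) S))
      (≡.trans (≡.sym (ℕ.+-suc _ ∣ S ∣))
    (≡.cong₂ ℕ._+_ (∣⊤∣≡n (#leaves l)) eq))) (∣coSingletons∣ r)))

module Families {c ℓ₁ ℓ₂} (K : OrderedField c ℓ₁ ℓ₂) where
  open OrderedField K
  open FieldProperties K
  open JoinWeight K

  Even⇒⊙≈ : ∀ {n} x → Even n → n ⊙ x ≈ 0#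
  Even⇒⊙≈ x (k , ≡.refl) = even⊙ k x

  Odd⇒⊙≈ : ∀ {n} x → Odd n → n ⊙ x ≈ x
  Odd⇒⊙≈ x (k , ≡.refl) = odd⊙ k x

  -- Colour the edges of the tree with three colours such that the edges at an internal node
  -- have different colours. For each colour take the set of leaves without it. E belongs to
  -- the colour of an edge above the root, O and O′ to the other two colours. Every edge lies
  -- in exactly two of the three joins.
  record Colouring t (w : Edge t → Carrier) : Set ℓ₁ where
    field
      E O O′  : Subset (#leaves t)
      even    : Even ∣ E ∣
      odd     : Odd ∣ O ∣
      odd′    : Odd ∣ O′ ∣
      sizes   : ∣ E ∣ ℕ.+ ∣ O ∣ ℕ.+ ∣ O′ ∣ ≡ 2 ℕ.* #leaves t
      weights : w[J] t w E + w[J] t w O + w[J] t w O′ ≈ ⟦ 2 ⟧ * w[E] t w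

  ⟦2⟧* : ∀ x → ⟦ 2 ⟧ * x ≈ x + x
  ⟦2⟧* x = trans (distribʳ x 1# ⟦ 1 ⟧) (+-cong (*-identityˡ x)
      (trans (*-congʳ ⟦1⟧≈1) (*-identityˡ x)))

  -- A leaf has the colour of the edge above it, so its `E` is empty. At a node the left edge gets
  -- the colour of `O` and the right edge that of `O′`; this dictates which sets of the subtrees are
  -- joined.
  colouring : ∀ t w → Colouring t w
  colouring leaf w = record
    { E = ⊥ ; O = ⊤ ; O′ = ⊤
    ; even = 0 , ≡.refl ; odd = 0 , ≡.refl ; odd′ = 0 , ≡.refl
    ; sizes = ≡.refl
    ; weights = trans (+-identityʳ _) (trans (+-identityʳ 0#) (sym (zeroʳ ⟦ 2 ⟧)))
    }
  colouring (node l r) w = record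
    { E = L.O Vec.++ R.O ; O = L.E Vec.++ R.O′ ; O′ = L.O′ Vec.++ R.E
    ; even = ≡.subst Even (≡.sym (∣++∣ L.O R.O)) (odd+odd L.odd R.odd)
    ; odd  = ≡.subst Odd (≡.sym (∣++∣ L.E R.O′)) (even+odd L.even R.odd′)
    ; odd′ = ≡.subst Odd (≡.sym (∣++∣ L.O′ R.E)) (odd+even L.odd′ R.even)
    ; sizes = begin
        _ ≡⟨ ≡.cong₂ ℕ._+_ (≡.cong₂ ℕ._+_ (∣++∣ L.O R.O) (∣++∣ L.E R.O′)) (∣++∣ L.O′ R.E) ⟩
        _ ≡⟨ rotate (∣ L.E ∣) (∣ L.O ∣) (∣ L.O′ ∣) (∣ R.E ∣) (∣ R.O ∣) (∣ R.O′ ∣) ⟩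
        _ ≡⟨ ≡.cong₂ ℕ._+_ L.sizes R.sizes ⟩
        _ ≡⟨ ℕ.*-distribˡ-+ 2 (#leaves l) (#leaves r) ⟨
        _ ∎
    -- The left root edge counts for `L.O` and `L.O′`, the right one for `R.O` and `R.O′`, hence
    -- each exactly twice.
    ; weights = trans (+-cong (+-cong
        (trans (w[J]-node l r w L.O R.O) (+-congʳ (+-cong (Odd⇒⊙≈ _ L.odd) (Odd⇒⊙≈ _ R.odd))))
        (trans (w[J]-node l r w L.E R.O′) (+-congʳ (+-cong (Even⇒⊙≈ _ L.even) (Odd⇒⊙≈ _ R.odd′)))))
        (trans (w[J]-node l r w L.O′ R.E) (+-congʳ (+-cong (Odd⇒⊙≈ _ L.odd′) (Even⇒⊙≈ _ R.even)))))
        (trans (solve 8 (λ x y e o o′ e₂ o₂ o₂′ →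
            (((x :+ y) :+ (o :+ o₂)) :+ ((con 0 :+ y) :+ (e :+ o₂′))) :+
                ((x :+ con 0) :+ (o′ :+ e₂)) :=
            ((x :+ x) :+ (y :+ y)) :+ (((e :+ o) :+ o′) :+ ((e₂ :+ o₂) :+ o₂′))) refl
            _ _ (w[J] l _ L.E) (w[J] l _ L.O) (w[J] l _ L.O′) (w[J] r _ R.E) (w[J] r _ R.O)
                (w[J] r _ R.O′))
        (trans (+-cong (sym (+-cong (⟦2⟧* (w toˡ)) (⟦2⟧* (w toʳ)))) (+-cong L.weights R.weights))
        (solve 5 (λ k x y a b → (k :* x :+ k :* y) :+ (k :* a :+ k :* b)
            := k :* ((x :+ y) :+ (a :+ b))) refl
          ⟦ 2 ⟧ _ _ _ _)))
    }
    where
    open ≡.≡-Reasoning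
    module ℕS = ℕ.+-*-Solver
    rotate : ∀ e o o′ e₂ o₂ o₂′ →
      (o ℕ.+ o₂) ℕ.+ (e ℕ.+ o₂′) ℕ.+ (o′ ℕ.+ e₂) ≡ (e ℕ.+ o ℕ.+ o′) ℕ.+ (e₂ ℕ.+ o₂ ℕ.+ o₂′)
    rotate = ℕS.solve 6 (λ e o o′ e₂ o₂ o₂′ →
      (o ℕS.:+ o₂) ℕS.:+ (e ℕS.:+ o₂′) ℕS.:+ (o′ ℕS.:+ e₂) ℕS.:=
      (e ℕS.:+ o ℕS.:+ o′) ℕS.:+ (e₂ ℕS.:+ o₂ ℕS.:+ o₂′)) ≡.refl
    module L = Colouring (colouring l (w ∘ inˡ))
    module R = Colouring (colouring r (w ∘ inʳ))

  -- Unlike in `Colouring` all three sets are even, as the supporting line bounds the joins of even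
  -- sets only.
  record Triple t (w : Edge t → Carrier) : Set ℓ₁ where
    field
      A B C   : Subset (#leaves t)
      evenA   : Even ∣ A ∣
      evenB   : Even ∣ B ∣
      evenC   : Even ∣ C ∣
      sizes   : ∣ A ∣ ℕ.+ ∣ B ∣ ℕ.+ ∣ C ∣ ≡ 2 ℕ.* #leaves t
      weights : w[J] t w A + w[J] t w B + w[J] t w C ≈ ⟦ 2 ⟧ * w[E] t w

  -- At the root both edges get the same colour.
  triple : ∀ l r w → Triple (node l r) w
  triple l r w = record
    { A = L.E Vec.++ R.E ; B = L.O Vec.++ R.O ; C = L.O′ Vec.++ R.O′
    ; evenA = ≡.subst Even (≡.sym (∣++∣ L.E R.E)) (even+even L.even R.even)
    ; evenB = ≡.subst Even (≡.sym (∣++∣ L.O R.O)) (odd+odd L.odd R.odd)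
    ; evenC = ≡.subst Even (≡.sym (∣++∣ L.O′ R.O′)) (odd+odd L.odd′ R.odd′)
    ; sizes = begin
        _ ≡⟨ ≡.cong₂ ℕ._+_ (≡.cong₂ ℕ._+_ (∣++∣ L.E R.E) (∣++∣ L.O R.O)) (∣++∣ L.O′ R.O′) ⟩
        _ ≡⟨ regroup (∣ L.E ∣) (∣ L.O ∣) (∣ L.O′ ∣) (∣ R.E ∣) (∣ R.O ∣) (∣ R.O′ ∣) ⟩
        _ ≡⟨ ≡.cong₂ ℕ._+_ L.sizes R.sizes ⟩
        _ ≡⟨ ℕ.*-distribˡ-+ 2 (#leaves l) (#leaves r) ⟨
        _ ∎
    ; weights = trans (+-cong (+-cong
        (trans (w[J]-node l r w L.E R.E) (+-congʳ (+-cong (Even⇒⊙≈ _ L.even) (Even⇒⊙≈ _ R.even))))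
        (trans (w[J]-node l r w L.O R.O) (+-congʳ (+-cong (Odd⇒⊙≈ _ L.odd) (Odd⇒⊙≈ _ R.odd)))))
        (trans (w[J]-node l r w L.O′ R.O′) (+-congʳ (+-cong (Odd⇒⊙≈ _ L.odd′) (Odd⇒⊙≈ _ R.odd′)))))
        (trans (solve 8 (λ x y e o o′ e₂ o₂ o₂′ →
            (((con 0 :+ con 0) :+ (e :+ e₂)) :+ ((x :+ y) :+ (o :+ o₂))) :+
                ((x :+ y) :+ (o′ :+ o₂′)) :=
            ((x :+ x) :+ (y :+ y)) :+ (((e :+ o) :+ o′) :+ ((e₂ :+ o₂) :+ o₂′))) refl
            _ _ (w[J] l _ L.E) (w[J] l _ L.O) (w[J] l _ L.O′) (w[J] r _ R.E) (w[J] r _ R.O)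
                (w[J] r _ R.O′))
        (trans (+-cong (sym (+-cong (⟦2⟧* (w toˡ)) (⟦2⟧* (w toʳ)))) (+-cong L.weights R.weights))
        (solve 5 (λ k x y a b → (k :* x :+ k :* y) :+ (k :* a :+ k :* b)
            := k :* ((x :+ y) :+ (a :+ b))) refl
          ⟦ 2 ⟧ _ _ _ _)))
    }
    where
    open ≡.≡-Reasoning
    module ℕS = ℕ.+-*-Solver
    regroup : ∀ e o o′ e₂ o₂ o₂′ →
      (e ℕ.+ e₂) ℕ.+ (o ℕ.+ o₂) ℕ.+ (o′ ℕ.+ o₂′) ≡ (e ℕ.+ o ℕ.+ o′) ℕ.+ (e₂ ℕ.+ o₂ ℕ.+ o₂′)
    regroup = ℕS.solve 6 (λ e o o′ e₂ o₂ o₂′ →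
      (e ℕS.:+ e₂) ℕS.:+ (o ℕS.:+ o₂) ℕS.:+ (o′ ℕS.:+ o₂′) ℕS.:=
      (e ℕS.:+ o ℕS.:+ o′) ℕS.:+ (e₂ ℕS.:+ o₂ ℕS.:+ o₂′)) ≡.refl
    module L = Colouring (colouring l (w ∘ inˡ))
    module R = Colouring (colouring r (w ∘ inʳ))

  -- If n = suc k leaves lie below an edge and z elsewhere, then removing a single leaf below
  -- or elsewhere leaves k or suc k leaves below it. As n + z is odd, the even one of n and z
  -- counts the removals that leave an odd number below the edge.
  removals : ∀ k z x → 0# ≤ x → Odd (suc k ℕ.+ z) → 1 ℕ.≤ z →
    ⟦ 2 ⟧ * x ≤ ⟦ suc k ⟧ * (k ⊙ x) + ⟦ z ⟧ * (suc k ⊙ x)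
  removals k z x 0≤x n+z-odd 1≤z with even⊎odd k
  -- For even `k` the number `z` is even and positive, hence at least 2.
  removals k 1 x 0≤x n+z-odd 1≤z | inj₁ (i , ≡.refl) =
    contradiction n+z-odd (¬Even×Odd (odd+odd (i , ≡.refl) (0 , ≡.refl)))
  removals k (suc (suc z)) x 0≤x n+z-odd 1≤z | inj₁ (i , ≡.refl) = begin
    ⟦ 2 ⟧ * x                 ≤⟨ *-monoˡ-≤ x 0≤x (⟦⟧-mono {2} {2 ℕ.+ z} (s≤s (s≤s z≤n))) ⟩
    ⟦ 2 ℕ.+ z ⟧ * x           ≈⟨ trans (+-cong (zeroʳ _) (*-congˡ (odd⊙ i x))) (+-identityˡ _) ⟨
    ⟦ suc k ⟧ * 0# + ⟦ 2 ℕ.+ z ⟧ * (suc k ⊙ x) ≈⟨ +-congʳ (*-congˡ (even⊙ i x)) ⟨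
    ⟦ suc k ⟧ * (k ⊙ x) + ⟦ 2 ℕ.+ z ⟧ * (suc k ⊙ x) ∎
    where open ≤-Reasoning
  -- For odd `k` the factor `suc k` is at least 2, and the second summand vanishes.
  removals k z x 0≤x n+z-odd 1≤z | inj₂ (i , ≡.refl) = begin
    ⟦ 2 ⟧ * x                 ≤⟨ *-monoˡ-≤ x 0≤x (⟦⟧-mono {2} {suc k} (s≤s (s≤s z≤n))) ⟩
    ⟦ suc k ⟧ * x
      ≈⟨ trans (+-cong (*-congˡ (odd⊙ i x)) (trans (*-congˡ (even⊙ i x)) (zeroʳ ⟦ z ⟧)))
          (+-identityʳ _) ⟨
    ⟦ suc k ⟧ * (k ⊙ x) + ⟦ z ⟧ * (suc k ⊙ x) ∎
    where open ≤-Reasoning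

  -- Applied at a node with `x` the weight from the root edges and from the subtree that loses no
  -- leaf, which is the same for all removals in the other subtree.
  ∑-const+ : ∀ {a p} {A : Set a} {P : A → Set p} {f g : A → Carrier} {x} {xs : List A} →
    (∀ {y} → P y → f y ≈ x + g y) → All P xs → ∑ f xs ≈ ⟦ length xs ⟧ * x + ∑ g xs
  ∑-const+ f≈ [] = sym (trans (+-congʳ (zeroˡ _)) (+-identityˡ 0#))
  ∑-const+ {x = x} f≈ (py ∷ pys) = trans (+-cong (f≈ py) (∑-const+ f≈ pys))
    (solve 4 (λ x g n s → (x :+ g) :+ (n :* x :+ s) := (con 1 :+ n) :* x :+ (g :+ s)) refl x _ _ _)

  -- The z copies of ⊤ stand for the removals of leaves outside of t in a larger tree.
  coSingletons-weight : ∀ t w → (∀ e → 0# ≤ w e) → ∀ z → Odd (#leaves t ℕ.+ z) →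
    ⟦ 2 ⟧ * w[E] t w ≤ ∑ (w[J] t w) (coSingletons t) + ⟦ z ⟧ * w[J] t w ⊤
  coSingletons-weight leaf w 0≤w z _ = ≤-reflexive (trans (zeroʳ ⟦ 2 ⟧)
    (sym (trans (+-cong (+-identityʳ 0#) (zeroʳ ⟦ z ⟧)) (+-identityʳ 0#))))
  coSingletons-weight (node l r) w 0≤w z odd with #leaves≡suc l | #leaves≡suc r
  ... | nl , #l | nr , #r = begin
    ⟦ 2 ⟧ * ((x + y) + (w[E] l wl + w[E] r wr))
      ≈⟨ solve 5 (λ k x y a b → k :* ((x :+ y) :+ (a :+ b)) :=
           (k :* x :+ k :* y) :+ (k :* a :+ k :* b)) refl ⟦ 2 ⟧ x y _ _ ⟩
    (⟦ 2 ⟧ * x + ⟦ 2 ⟧ * y) + (⟦ 2 ⟧ * w[E] l wl + ⟦ 2 ⟧ * w[E] r wr)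
      -- Seen from one subtree, the removals elsewhere are those in its sibling and the `z` outside
      -- the tree.
      ≤⟨ +-mono-≤ (+-mono-≤
           (removals nl (#leaves r ℕ.+ z) x (0≤w toˡ) (≡.subst (λ n → Odd (n ℕ.+ _)) #l odd-l)
               (pos r))
           (removals nr (#leaves l ℕ.+ z) y (0≤w toʳ) (≡.subst (λ n → Odd (n ℕ.+ _)) #r odd-r)
               (pos l)))
         (+-mono-≤ (coSingletons-weight l wl (0≤w ∘ inˡ) _ odd-l)
             (coSingletons-weight r wr (0≤w ∘ inʳ) _ odd-r)) ⟩
    ((⟦ suc nl ⟧ * x′ + ⟦ #leaves r ℕ.+ z ⟧ * (suc nl ⊙ x)) +
        (⟦ suc nr ⟧ * y′ + ⟦ #leaves l ℕ.+ z ⟧ * (suc nr ⊙ y))) +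
    ((cl + ⟦ #leaves r ℕ.+ z ⟧ * fl) + (cr + ⟦ #leaves l ℕ.+ z ⟧ * fr))
      ≈⟨ +-cong (+-cong
           (+-cong (*-congʳ (⟦⟧-cong (≡.sym #l)))
               (*-cong (⟦⟧-homo-+ (#leaves r) z) (⊙-congˡ x (≡.sym #l))))
           (+-cong (*-congʳ (⟦⟧-cong (≡.sym #r)))
               (*-cong (⟦⟧-homo-+ (#leaves l) z) (⊙-congˡ y (≡.sym #r)))))
           (+-cong (+-congˡ (*-congʳ (⟦⟧-homo-+ (#leaves r) z)))
               (+-congˡ (*-congʳ (⟦⟧-homo-+ (#leaves l) z)))) ⟩
    ((m * x′ + (n + ⟦ z ⟧) * x₁) + (n * y′ + (m + ⟦ z ⟧) * y₁)) +
    ((cl + (n + ⟦ z ⟧) * fl) + (cr + (m + ⟦ z ⟧) * fr))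
      ≈⟨ solve 11 (λ m n z x′ x₁ y′ y₁ cl fl cr fr →
           ((m :* x′ :+ (n :+ z) :* x₁) :+ (n :* y′ :+ (m :+ z) :* y₁)) :+
           ((cl :+ (n :+ z) :* fl) :+ (cr :+ (m :+ z) :* fr)) :=
           ((m :* ((x′ :+ y₁) :+ fr) :+ cl) :+ (n :* ((x₁ :+ y′) :+ fl) :+ cr)) :+
           z :* ((x₁ :+ y₁) :+ (fl :+ fr))) refl m n ⟦ z ⟧ x′ x₁ y′ y₁ cl fl cr fr ⟩
    ((m * ((x′ + y₁) + fr) + cl) + (n * ((x₁ + y′) + fl) + cr)) + ⟦ z ⟧ * ((x₁ + y₁) + (fl + fr))
      ≈⟨ +-cong (+-cong left right) (*-congˡ top) ⟨
    (∑ (f ∘ (Vec._++ ⊤)) (coSingletons l) + ∑ (f ∘ (⊤ Vec.++_)) (coSingletons r)) + ⟦ z ⟧ * f ⊤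
      ≡⟨ ≡.cong₂ (λ a b → (a + b) + ⟦ z ⟧ * f ⊤) (∑-map f (Vec._++ ⊤) (coSingletons l))
          (∑-map f (⊤ Vec.++_) (coSingletons r)) ⟨
    (∑ f (map (Vec._++ ⊤) (coSingletons l)) + ∑ f (map (⊤ Vec.++_) (coSingletons r))) + ⟦ z ⟧ * f ⊤
      ≈⟨ +-congʳ (∑-++ f (map (Vec._++ ⊤) (coSingletons l)) _) ⟨
    ∑ f (coSingletons (node l r)) + ⟦ z ⟧ * f ⊤ ∎
    where
    open ≤-Reasoning
    f = w[J] (node l r) w
    wl = w ∘ inˡ
    wr = w ∘ inʳ
    m = ⟦ #leaves l ⟧
    n = ⟦ #leaves r ⟧
    x = w toˡ
    y = w toʳ
    x′ = nl ⊙ x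
    y′ = nr ⊙ y
    x₁ = #leaves l ⊙ x
    y₁ = #leaves r ⊙ y
    cl = ∑ (w[J] l wl) (coSingletons l)
    cr = ∑ (w[J] r wr) (coSingletons r)
    fl = w[J] l wl ⊤
    fr = w[J] r wr ⊤
    odd-l : Odd (#leaves l ℕ.+ (#leaves r ℕ.+ z))
    odd-l = ≡.subst Odd (ℕ.+-assoc (#leaves l) (#leaves r) z) odd
    odd-r : Odd (#leaves r ℕ.+ (#leaves l ℕ.+ z))
    odd-r = ≡.subst Odd (≡.trans (≡.cong (ℕ._+ z) (ℕ.+-comm (#leaves l) (#leaves r)))
      (ℕ.+-assoc (#leaves r) (#leaves l) z)) odd
    pos : ∀ t → 1 ℕ.≤ #leaves t ℕ.+ z
    pos t = ℕ.≤-trans (ℕ.>-nonZero⁻¹ _ ⦃ #leaves-nonZero t ⦄) (ℕ.m≤m+n _ z)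
    top : f ⊤ ≈ (x₁ + y₁) + (fl + fr)
    top = trans (reflexive (≡.cong f (≡.sym (⊤++⊤ (#leaves l))))) (trans (w[J]-node l r w ⊤ ⊤)
      (+-congʳ (+-cong (⊙-congˡ x (∣⊤∣≡n (#leaves l))) (⊙-congˡ y (∣⊤∣≡n (#leaves r))))))
    left : ∑ (f ∘ (Vec._++ ⊤)) (coSingletons l) ≈ m * ((x′ + y₁) + fr) + cl
    left = trans (∑-const+ (λ {S} eq → trans (w[J]-node l r w S ⊤)
        (trans (+-cong (+-cong (⊙-congˡ x (ℕ.suc-injective (≡.trans eq #l)))
            (⊙-congˡ y (∣⊤∣≡n (#leaves r)))) (+-comm _ _))
               (sym (+-assoc _ _ _))))
        (∣coSingletons∣ l)) (+-congʳ (*-congʳ (⟦⟧-cong (length-coSingletons l))))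
    right : ∑ (f ∘ (⊤ Vec.++_)) (coSingletons r) ≈ n * ((x₁ + y′) + fl) + cr
    right = trans (∑-const+ (λ {S} eq → trans (w[J]-node l r w ⊤ S)
        (trans (+-congʳ (+-cong (⊙-congˡ x (∣⊤∣≡n (#leaves l)))
            (⊙-congˡ y (ℕ.suc-injective (≡.trans eq #r)))))
               (sym (+-assoc _ _ _))))
        (∣coSingletons∣ r)) (+-congʳ (*-congʳ (⟦⟧-cong (length-coSingletons r))))

-- The lower bound, from values of the supporting line.

module LowerBound {c ℓ₁ ℓ₂} (K : OrderedField c ℓ₁ ℓ₂) where
  open OrderedField K
  open FieldProperties K
  open JoinWeight K
  open Concavity K
  open Families K

  -- Every line above the doubled weights of even joins is large at the relevant sizes. This yields
  -- a bound for a set because the supporting line takes the value `2 f(S)` at the size of `S`.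
  module Line (l r : Tree) (w : Edge (node l r) → Carrier) (0≤w : ∀ e → 0# ≤ w e) (U σ : Carrier)
    (line : ∀ T → Even ∣ T ∣ → ⟦ 2 ⟧ * w[J] (node l r) w T ≤ U + ⟦ ∣ T ∣ ⟧ * σ) where

    private
      t = node l r
      m = #leaves t
      W = w[E] t w
      f = w[J] t w

    open ≤-Reasoning
    open Triple (triple l r w)

    0≤U : 0# ≤ U
    0≤U = begin
      0#                 ≤⟨ *-nonNeg 0≤⟦ 2 ⟧ (w[J]-nonNeg t w 0≤w ⊥) ⟩
      ⟦ 2 ⟧ * f ⊥        ≤⟨ line ⊥ (0 , ∣⊥∣≡0 m) ⟩
      U + ⟦ ∣ ⊥ {m} ∣ ⟧ * σ ≈⟨ +-congˡ (trans (*-congʳ (⟦⟧-cong (∣⊥∣≡0 m))) (zeroˡ σ)) ⟩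
      U + 0#             ≈⟨ +-identityʳ U ⟩
      U                  ∎

    -- The average size of `A`, `B`, `C` is `2m/3`, so adding up the line over them gives three
    -- times its value there.
    triple-line : ⟦ 2 ⟧ * (⟦ 2 ⟧ * W) ≤ ⟦ 3 ⟧ * U + ⟦ 2 ℕ.* m ⟧ * σ
    triple-line = begin
      ⟦ 2 ⟧ * (⟦ 2 ⟧ * W)              ≈⟨ *-congˡ weights ⟨
      ⟦ 2 ⟧ * (f A + f B + f C)
        ≈⟨ solve 4 (λ k a b c → k :* (a :+ b :+ c) := k :* a :+ k :* b :+ k :* c) refl ⟦ 2 ⟧
            (f A) (f B) (f C) ⟩
      ⟦ 2 ⟧ * f A + ⟦ 2 ⟧ * f B + ⟦ 2 ⟧ * f C
        ≤⟨ +-mono-≤ (+-mono-≤ (line A evenA) (line B evenB)) (line C evenC) ⟩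
      (U + a * σ) + (U + b * σ) + (U + d * σ)
        ≈⟨ solve 5 (λ u s a b d → (u :+ a :* s) :+ (u :+ b :* s) :+ (u :+ d :* s) :=
             (u :+ (u :+ (u :+ con 0))) :+ (a :+ b :+ d) :* s) refl U σ a b d ⟩
      (U + (U + (U + 0#))) + (a + b + d) * σ
        ≈⟨ +-cong three (*-congʳ (trans (⟦⟧-cong (≡.sym sizes))
            (trans (⟦⟧-homo-+ (∣ A ∣ ℕ.+ ∣ B ∣) ∣ C ∣) (+-congʳ (⟦⟧-homo-+ ∣ A ∣ ∣ B ∣))))) ⟨
      ⟦ 3 ⟧ * U + ⟦ 2 ℕ.* m ⟧ * σ      ∎
      where
      a = ⟦ ∣ A ∣ ⟧
      b = ⟦ ∣ B ∣ ⟧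
      d = ⟦ ∣ C ∣ ⟧
      three : ⟦ 3 ⟧ * U ≈ U + (U + (U + 0#))
      three = trans (×-assoc-* 3 1# U) (×-congʳ 3 (*-identityˡ U))

    -- Interpolation between 0, where the line is nonnegative, and `2m/3`, where `triple-line`
    -- applies.
    few : ∀ q → 3 ℕ.* q ℕ.≤ 2 ℕ.* m → ⟦ q ⟧ * (⟦ 2 ⟧ * W) ≤ ⟦ m ⟧ * (U + ⟦ q ⟧ * σ)
    few q 3q≤2m = begin
      ⟦ q ⟧ * (⟦ 2 ⟧ * W)
        ≤⟨ affine-≤ {a = 0} {r = q} (⟦ m ⟧ * U) (⟦ m ⟧ * σ) (⟦ 2 ⟧ * W) z≤n 3q≤2m at-0 at-2m ⟩
      ⟦ m ⟧ * U + ⟦ q ⟧ * (⟦ m ⟧ * σ)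
        ≈⟨ solve 4 (λ m u q b → m :* u :+ q :* (m :* b) := m :* (u :+ q :* b)) refl _ _ _ _ ⟩
      ⟦ m ⟧ * (U + ⟦ q ⟧ * σ) ∎
      where
      at-0 : 0# * (⟦ 2 ⟧ * W) ≤ ⟦ m ⟧ * U + 0# * (⟦ m ⟧ * σ)
      at-0 = begin
        0# * (⟦ 2 ⟧ * W)  ≈⟨ zeroˡ _ ⟩
        0#                ≤⟨ *-nonNeg 0≤⟦ m ⟧ 0≤U ⟩
        ⟦ m ⟧ * U         ≈⟨ trans (+-congˡ (zeroˡ _)) (+-identityʳ _) ⟨
        ⟦ m ⟧ * U + 0# * (⟦ m ⟧ * σ) ∎
      at-2m : ⟦ 2 ℕ.* m ⟧ * (⟦ 2 ⟧ * W) ≤ ⟦ 3 ⟧ * (⟦ m ⟧ * U) + ⟦ 2 ℕ.* m ⟧ * (⟦ m ⟧ * σ)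
      at-2m = begin
        ⟦ 2 ℕ.* m ⟧ * (⟦ 2 ⟧ * W)
          ≈⟨ trans (*-congʳ (trans (×1-homo-* 2 m) (*-comm ⟦ 2 ⟧ ⟦ m ⟧))) (*-assoc ⟦ m ⟧ ⟦ 2 ⟧ _) ⟩
        ⟦ m ⟧ * (⟦ 2 ⟧ * (⟦ 2 ⟧ * W))     ≤⟨ *-monoʳ-≤ ⟦ m ⟧ 0≤⟦ m ⟧ triple-line ⟩
        ⟦ m ⟧ * (⟦ 3 ⟧ * U + ⟦ 2 ℕ.* m ⟧ * σ)
          ≈⟨ solve 5 (λ m k u n b → m :* (k :* u :+ n :* b) := k :* (m :* u) :+ n :* (m :* b))
              refl ⟦ m ⟧ ⟦ 3 ⟧ U ⟦ 2 ℕ.* m ⟧ σ ⟩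
        ⟦ 3 ⟧ * (⟦ m ⟧ * U) + ⟦ 2 ℕ.* m ⟧ * (⟦ m ⟧ * σ) ∎

    -- With i leaves missing from S, the inequality to prove is i c₀ ≤ V.
    V c₀ : Carrier
    V = ⟦ m ⟧ * (U + ⟦ m ⟧ * σ)
    c₀ = ⟦ m ⟧ * σ + ⟦ 2 ⟧ * (⟦ 2 ⟧ * W)

    -- Three times the inequality for `i = m/3`, that is, for the size `2m/3` of `triple-line`.
    at-m : ⟦ m ⟧ * c₀ ≤ ⟦ 3 ⟧ * V + ⟦ m ⟧ * 0#
    at-m = begin
      ⟦ m ⟧ * c₀ ≤⟨ *-monoʳ-≤ ⟦ m ⟧ 0≤⟦ m ⟧ (+-monoʳ-≤ _ triple-line) ⟩
      ⟦ m ⟧ * (⟦ m ⟧ * σ + (⟦ 3 ⟧ * U + ⟦ 2 ℕ.* m ⟧ * σ))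
        ≈⟨ *-congˡ (+-congˡ (+-congˡ (*-congʳ (×1-homo-* 2 m)))) ⟩
      ⟦ m ⟧ * (⟦ m ⟧ * σ + (⟦ 3 ⟧ * U + ⟦ 2 ⟧ * ⟦ m ⟧ * σ))
        ≈⟨ solve 4 (λ m b u k → m :* (m :* b :+ ((con 1 :+ k) :* u :+ k :* m :* b)) :=
             (con 1 :+ k) :* (m :* (u :+ m :* b)) :+ m :* con 0) refl ⟦ m ⟧ σ U ⟦ 2 ⟧ ⟩
      ⟦ 3 ⟧ * V + ⟦ m ⟧ * 0# ∎

    at-0 : Even m → ⟦ 0 ⟧ * c₀ ≤ V + ⟦ 0 ⟧ * 0#
    at-0 m-even = begin
      0# * c₀                ≈⟨ zeroˡ c₀ ⟩
      0#                     ≈⟨ zeroʳ ⟦ m ⟧ ⟨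
      ⟦ m ⟧ * 0#             ≤⟨ *-monoʳ-≤ ⟦ m ⟧ 0≤⟦ m ⟧ (*-nonNeg 0≤⟦ 2 ⟧ (w[J]-nonNeg t w 0≤w ⊤)) ⟩
      ⟦ m ⟧ * (⟦ 2 ⟧ * f ⊤)
        ≤⟨ *-monoʳ-≤ ⟦ m ⟧ 0≤⟦ m ⟧ (line ⊤ (≡.subst Even (≡.sym (∣⊤∣≡n m)) m-even)) ⟩
      ⟦ m ⟧ * (U + ⟦ ∣ ⊤ {m} ∣ ⟧ * σ) ≈⟨ *-congˡ (+-congˡ (*-congʳ (⟦⟧-cong (∣⊤∣≡n m)))) ⟩
      V                      ≈⟨ trans (+-congˡ (zeroˡ 0#)) (+-identityʳ V) ⟨
      V + 0# * 0#            ∎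

    -- For odd `m` the line need not bound `⊤`. The `m` sets omitting one leaf are even, and the
    -- line summed over them is `m` times its value at `m - 1`, while their joins weigh at least
    -- `2W` together.
    at-1 : Odd m → ⟦ 1 ⟧ * c₀ ≤ V + ⟦ 1 ⟧ * 0#
    at-1 (k , m≡) = begin
      ⟦ 1 ⟧ * c₀ ≈⟨ trans (*-congʳ ⟦1⟧≈1) (*-identityˡ c₀) ⟩
      c₀         ≤⟨ +-monoʳ-≤ _ (*-monoʳ-≤ ⟦ 2 ⟧ 0≤⟦ 2 ⟧ singles) ⟩
      ⟦ m ⟧ * σ + ⟦ 2 ⟧ * ∑ f (coSingletons t)
        ≤⟨ +-monoʳ-≤ _ (sum-line (coSingletons t) (∣coSingletons∣ t)) ⟩
      ⟦ m ⟧ * σ + ⟦ length (coSingletons t) ⟧ * (U + n′ * σ)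
        ≈⟨ +-congˡ (*-congʳ (⟦⟧-cong (length-coSingletons t))) ⟩
      ⟦ m ⟧ * σ + ⟦ m ⟧ * (U + n′ * σ)
        ≈⟨ solve 4 (λ m b u n → m :* b :+ m :* (u :+ n :* b) := m :* (u :+ (con 1 :+ n) :* b))
            refl ⟦ m ⟧ σ U n′ ⟩
      ⟦ m ⟧ * (U + ⟦ suc (k ℕ.* 2) ⟧ * σ) ≈⟨ *-congˡ (+-congˡ (*-congʳ (⟦⟧-cong m≡))) ⟨
      V                  ≈⟨ trans (+-congˡ (zeroʳ ⟦ 1 ⟧)) (+-identityʳ V) ⟨
      V + ⟦ 1 ⟧ * 0#     ∎
      where
      n′ = ⟦ k ℕ.* 2 ⟧
      singles : ⟦ 2 ⟧ * W ≤ ∑ f (coSingletons t)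
      singles = begin
        ⟦ 2 ⟧ * W
          ≤⟨ coSingletons-weight t w 0≤w 0 (≡.subst Odd (≡.sym (ℕ.+-identityʳ m)) (k , m≡)) ⟩
        ∑ f (coSingletons t) + 0# * f ⊤ ≈⟨ trans (+-congˡ (zeroˡ (f ⊤))) (+-identityʳ _) ⟩
        ∑ f (coSingletons t) ∎
      sum-line : ∀ Ts → All (λ T → suc ∣ T ∣ ≡ m) Ts → ⟦ 2 ⟧ * ∑ f Ts ≤ ⟦ length Ts ⟧ * (U + n′ * σ)
      sum-line [] [] = ≤-reflexive (trans (zeroʳ ⟦ 2 ⟧) (sym (zeroˡ _)))
      sum-line (T ∷ Ts) (eq ∷ eqs) = begin
        ⟦ 2 ⟧ * (f T + ∑ f Ts)           ≈⟨ distribˡ ⟦ 2 ⟧ _ _ ⟩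
        ⟦ 2 ⟧ * f T + ⟦ 2 ⟧ * ∑ f Ts     ≤⟨ +-mono-≤ (line T (k , ∣T∣≡)) (sum-line Ts eqs) ⟩
        (U + ⟦ ∣ T ∣ ⟧ * σ) + ⟦ length Ts ⟧ * (U + n′ * σ)
          ≈⟨ +-congʳ (trans (+-congˡ (*-congʳ (⟦⟧-cong ∣T∣≡))) (sym (*-identityˡ _))) ⟩
        1# * (U + n′ * σ) + ⟦ length Ts ⟧ * (U + n′ * σ) ≈⟨ distribʳ _ 1# _ ⟨
        ⟦ suc (length Ts) ⟧ * (U + n′ * σ) ∎
        where
        ∣T∣≡ = ℕ.suc-injective (≡.trans eq m≡)

    many : ∀ q r → Even q → q ℕ.+ r ≡ m → 3 ℕ.* r ℕ.≤ m →
      ⟦ r ⟧ * (⟦ 2 ⟧ * (⟦ 2 ⟧ * W)) ≤ ⟦ m ⟧ * (U + ⟦ q ⟧ * σ)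
    many q r q-even q+r≡m 3r≤m = +-cancelˡ-≤ (⟦ r ⟧ * (⟦ m ⟧ * σ)) (begin
      ⟦ r ⟧ * (⟦ m ⟧ * σ) + ⟦ r ⟧ * (⟦ 2 ⟧ * (⟦ 2 ⟧ * W)) ≈⟨ distribˡ ⟦ r ⟧ _ _ ⟨
      ⟦ r ⟧ * c₀   ≤⟨ at-r ⟩
      V + ⟦ r ⟧ * 0# ≈⟨ trans (+-congˡ (zeroʳ ⟦ r ⟧)) (+-identityʳ V) ⟩
      ⟦ m ⟧ * (U + ⟦ m ⟧ * σ)
        ≈⟨ *-congˡ (+-congˡ (*-congʳ (trans (⟦⟧-cong (≡.sym q+r≡m)) (⟦⟧-homo-+ q r)))) ⟩
      ⟦ m ⟧ * (U + (⟦ q ⟧ + ⟦ r ⟧) * σ)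
        ≈⟨ solve 5 (λ m u q r b → m :* (u :+ (q :+ r) :* b) := r :* (m :* b) :+ m :*
            (u :+ q :* b)) refl _ _ _ _ _ ⟩
      ⟦ r ⟧ * (⟦ m ⟧ * σ) + ⟦ m ⟧ * (U + ⟦ q ⟧ * σ) ∎)
      where
      at-r : ⟦ r ⟧ * c₀ ≤ V + ⟦ r ⟧ * 0#
      -- Interpolation starts at no missing leaf or at one, according to the parity of `m`; for odd
      -- `m` the even `q` differs from `m`, so `r` is at least 1.
      at-r with even⊎odd m
      ... | inj₁ m-even = affine-≤ {r = r} V 0# c₀ z≤n 3r≤m (at-0 m-even) at-m
      ... | inj₂ m-odd  = affine-≤ {r = r} V 0# c₀ (1≤r r q+r≡m) 3r≤m (at-1 m-odd) at-m
        where
        1≤r : ∀ r → q ℕ.+ r ≡ m → 1 ℕ.≤ r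
        1≤r zero    q+0≡m = contradiction m-odd
            (¬Even×Odd (≡.subst Even (≡.trans (≡.sym (ℕ.+-identityʳ q)) q+0≡m) q-even))
        1≤r (suc r) _     = s≤s z≤n

  -- The witness is a heaviest set of `q` leaves, at which the line is attained by `at-S`. Both
  -- bounds are multiplied by the number of leaves to avoid division.
  lower-bound : ∀ t (w : Edge t → Carrier) → (∀ e → 0# ≤ w e) → ∀ q →
    2 ∣ q → 2 ℕ.≤ q → q ℕ.≤ #leaves t →
    ∃[ S ] ∣ S ∣ ≡ q ×
      (3 ℕ.* q ℕ.≤ 2 ℕ.* #leaves t → ⟦ q ⟧ * w[E] t w ≤ ⟦ #leaves t ⟧ * w[J] t w S) ×
      (3 ℕ.* (#leaves t ℕ.∸ q) ℕ.≤ #leaves t →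
        ⟦ 2 ℕ.* (#leaves t ℕ.∸ q) ⟧ * w[E] t w ≤ ⟦ #leaves t ⟧ * w[J] t w S)
  lower-bound leaf w 0≤w q 2∣q 2≤q q≤1 = contradiction (ℕ.≤-trans 2≤q q≤1) (λ { (s≤s ()) })
  lower-bound (node l r) w 0≤w 1 2∣q (s≤s ()) q≤m
  lower-bound t@(node l r) w 0≤w q@(suc (suc q⁻)) 2∣q 2≤q q≤m
    with argmax (w[J] t w) q q≤m | argmax (w[J] t w) q⁻ (ℕ.≤-trans (ℕ.m≤n+m q⁻ 2) q≤m)
  ... | S , ∣S∣ , max | S⁻ , ∣S⁻∣ , max⁻ = S , ∣S∣ ,
    (λ 3q≤2m → halve (⟦ q ⟧) (trans (sym (*-assoc _ _ _))
        (trans (*-congʳ (*-comm _ _)) (*-assoc _ _ _))) (Ln.few q 3q≤2m)) ,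
    (λ 3r≤m → halve (⟦ 2 ℕ.* d ⟧)
       (trans (solve 3 (λ r k w → r :* (k :* (k :* w)) := k :* (k :* r :* w)) refl ⟦ d ⟧ ⟦ 2 ⟧ W)
         (*-congˡ (*-congʳ (sym (×1-homo-* 2 d)))))
       (Ln.many q d (ev 2∣q) (ℕ.m+[n∸m]≡n q≤m) 3r≤m))
    where
    module SL = SupportingLine t w q⁻ S⁻ ∣S⁻∣ max⁻ S ∣S∣ max
    m = #leaves t
    d = m ℕ.∸ q
    W = w[E] t w
    ev : ∀ {n} → 2 ∣ n → Even n
    ev (divides k eq) = k , eq
    line : ∀ T → Even ∣ T ∣ → ⟦ 2 ⟧ * w[J] t w T ≤ SL.intercept + ⟦ ∣ T ∣ ⟧ * SL.slope
    line T (k , eq) = SL.supporting-line T (∣m+n∣m⇒∣n 2∣q ∣-refl) (divides k eq)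
    module Ln = Line l r w 0≤w SL.intercept SL.slope line
    halve : ∀ x {y} → y ≈ ⟦ 2 ⟧ * (x * W) → y ≤ ⟦ m ⟧ * (SL.intercept + ⟦ q ⟧ * SL.slope) →
      x * W ≤ ⟦ m ⟧ * w[J] t w S
    halve x {y} y≈ y≤ = *-cancelˡ-≤ ⟦ 2 ⟧ 0<⟦suc 1 ⟧ (begin
      ⟦ 2 ⟧ * (x * W)               ≈⟨ y≈ ⟨
      y                             ≤⟨ y≤ ⟩
      ⟦ m ⟧ * (SL.intercept + ⟦ q ⟧ * SL.slope) ≈⟨ *-congˡ SL.at-S ⟨
      ⟦ m ⟧ * (⟦ 2 ⟧ * w[J] t w S)
        ≈⟨ solve 3 (λ m k x → m :* (k :* x) := k :* (m :* x)) refl _ _ _ ⟩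
      ⟦ 2 ⟧ * (⟦ m ⟧ * w[J] t w S)  ∎)
      where open ≤-Reasoning

-- Rational numbers by cross-multiplication.

toℚᵘ-/ : ∀ i n → toℚᵘ (i / suc n) ℚᵘ.≃ mkℚᵘ i n
toℚᵘ-/ i n = ℚ.toℚᵘ-fromℚᵘ (mkℚᵘ i n)

≤/⇒*≤* : ∀ x n m .⦃ _ : NonZero m ⦄ → x ℚ.≤ + n / m → ↥ x ℤ.* + m ℤ.≤ + n ℤ.* ↧ x
≤/⇒*≤* x@record{} n (suc m) x≤n/m = ℚᵘ.drop-*≤*
  (ℚᵘ.≤-respʳ-≃ (toℚᵘ-/ (+ n) m) (ℚ.toℚᵘ-mono-≤ x≤n/m))

≡/⇒*≡* : ∀ x n m .⦃ _ : NonZero m ⦄ → x ≡ + n / m → ↥ x ℤ.* + m ≡ + n ℤ.* ↧ x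
≡/⇒*≡* x@record{} n (suc m) x≡n/m = ℚᵘ.drop-*≡*
  (ℚᵘ.≃-trans (ℚᵘ.≃-reflexive (≡.cong toℚᵘ x≡n/m)) (toℚᵘ-/ (+ n) m))

/≡ : ∀ n m .⦃ _ : NonZero m ⦄ x → ↥ x ℤ.* + m ≡ + n ℤ.* ↧ x → + n / m ≡ x
/≡ n (suc m) x@record{} eq = ℚ.toℚᵘ-injective (ℚᵘ.≃-trans (toℚᵘ-/ (+ n) m) (*≡* (≡.sym eq)))

2*[1-q/m]≡ : ∀ q m .⦃ _ : NonZero m ⦄ → q ℕ.≤ m →
  (+ 2 / 1) ℚ.* (1ℚ ℚ.- (+ q / m)) ≡ + (2 ℕ.* (m ℕ.∸ q)) / m
2*[1-q/m]≡ q (suc m) q≤m = ℚ.toℚᵘ-injective (begin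
  toℚᵘ ((+ 2 / 1) ℚ.* (1ℚ ℚ.- p))
    ≈⟨ ℚ.toℚᵘ-homo-* (+ 2 / 1) (1ℚ ℚ.- p) ⟩
  mkℚᵘ (+ 2) 0 ℚᵘ.* toℚᵘ (1ℚ ℚ.- p)
    ≈⟨ ℚᵘ.*-congˡ {mkℚᵘ (+ 2) 0} (ℚ.toℚᵘ-homo-+ 1ℚ (ℚ.- p)) ⟩
  mkℚᵘ (+ 2) 0 ℚᵘ.* (mkℚᵘ (+ 1) 0 ℚᵘ.+ toℚᵘ (ℚ.- p))
    ≈⟨ ℚᵘ.*-congˡ {mkℚᵘ (+ 2) 0} (ℚᵘ.+-congʳ (mkℚᵘ (+ 1) 0)
         (ℚᵘ.≃-trans (ℚ.toℚᵘ-homo‿- p) (ℚᵘ.-‿cong (toℚᵘ-/ (+ q) m)))) ⟩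
  mkℚᵘ (+ 2) 0 ℚᵘ.* (mkℚᵘ (+ 1) 0 ℚᵘ.- mkℚᵘ (+ q) m)
    ≈⟨ *≡* (numerators (+ q) (+ r) (+ suc m) (≡.cong +_ (≡.sym (ℕ.m+[n∸m]≡n q≤m)))) ⟩
  mkℚᵘ (+ 2 ℤ.* + r) m
    ≡⟨ ≡.cong (λ i → mkℚᵘ i m) (ℤ.pos-* 2 r) ⟨
  mkℚᵘ (+ (2 ℕ.* r)) m
    ≈⟨ toℚᵘ-/ (+ (2 ℕ.* r)) m ⟨
  toℚᵘ (+ (2 ℕ.* r) / suc m) ∎)
  where
  open ℚᵘ.≃-Reasoning
  p = + q / suc m
  r = suc m ℕ.∸ q
  numerators : ∀ q r m → m ≡ q ℤ.+ r → + 2 ℤ.* (+ 1 ℤ.* m ℤ.+ (ℤ.- q) ℤ.* + 1) ℤ.* m ≡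
    + 2 ℤ.* r ℤ.* (+ 1 ℤ.* (+ 1 ℤ.* m))
  numerators q r _ ≡.refl = solve 2 (λ q r →
    con (+ 2) :* (con (+ 1) :* (q :+ r) :+ (:- q) :* con (+ 1)) :* (q :+ r) :=
    con (+ 2) :* r :* (con (+ 1) :* (con (+ 1) :* (q :+ r)))) ≡.refl q r
    where open ℤ.+-*-Solver

-- Caterpillars carrying copies of a fixed tree.

comb : Tree → ℕ → Tree
comb g zero    = g
comb g (suc n) = node g (comb g n)

#leaves-comb : ∀ g n → #leaves (comb g n) ≡ suc n ℕ.* #leaves g
#leaves-comb g zero    = ≡.sym (ℕ.*-identityˡ (#leaves g))
#leaves-comb g (suc n) = ≡.cong (#leaves g ℕ.+_) (#leaves-comb g n)

-- Used with `X` odd and `Y` even: the join then contains the edges above exactly `r` of the copies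
-- of `g`.
pick : ∀ {g} → Subset (#leaves g) → Subset (#leaves g) → ∀ n → ℕ → Subset (#leaves (comb g n))
pick X Y zero    zero    = Y
pick X Y zero    (suc r) = X
pick X Y (suc n) zero    = Y Vec.++ pick X Y n zero
pick X Y (suc n) (suc r) = X Vec.++ pick X Y n r

∣pick∣ : ∀ {g} (X Y : Subset (#leaves g)) n r → r ℕ.≤ suc n →
  ∣ pick {g} X Y n r ∣ ≡ r ℕ.* ∣ X ∣ ℕ.+ (suc n ℕ.∸ r) ℕ.* ∣ Y ∣
∣pick∣ X Y zero zero _ = ≡.sym (ℕ.*-identityˡ ∣ Y ∣)
∣pick∣ X Y zero (suc zero) _ = ≡.sym (≡.trans (ℕ.+-identityʳ _) (ℕ.*-identityˡ ∣ X ∣))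
∣pick∣ X Y zero (suc (suc r)) (s≤s ())
∣pick∣ {g} X Y (suc n) zero _ = ≡.trans (∣++∣ Y _) (≡.cong (∣ Y ∣ ℕ.+_) (∣pick∣ {g} X Y n zero z≤n))
∣pick∣ {g} X Y (suc n) (suc r) (s≤s r≤n) = ≡.trans (∣++∣ X _)
  (≡.trans (≡.cong (∣ X ∣ ℕ.+_) (∣pick∣ {g} X Y n r r≤n)) (≡.sym (ℕ.+-assoc ∣ X ∣ _ _)))

cherry : Tree
cherry = node leaf leaf

-- Embedding of the rationals, and join weights in the extremal trees.

module Tightness {c ℓ₁ ℓ₂} (K : OrderedField c ℓ₁ ℓ₂) where
  open OrderedField K hiding (zero)
  open FieldProperties K
  open JoinWeight K

  ↧*fromℚ : ∀ x → ⟦ ↧ₙ x ⟧ * fromℚ x ≈ fromℤ (↥ x)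
  ↧*fromℚ x@(mkℚ _ d _) = trans (*-comm _ _) (trans (*-assoc _ _ _)
    (trans (*-congˡ (trans (*-comm _ _) (⁻¹-inverseʳ _ (proj₂ 0<⟦suc d ⟧ ∘ sym)))) (*-identityʳ _)))

  fromℚ-≤ : ∀ x n m → ↥ x ℤ.* + m ℤ.≤ + n ℤ.* ↧ x → ⟦ m ⟧ * fromℚ x ≤ ⟦ n ⟧
  fromℚ-≤ x@(mkℚ a d _) n m le = *-cancelˡ-≤ ⟦ suc d ⟧ 0<⟦suc d ⟧ (begin
    ⟦ suc d ⟧ * (⟦ m ⟧ * fromℚ x)
      ≈⟨ solve 3 (λ d m x → d :* (m :* x) := m :* (d :* x)) refl _ _ _ ⟩
    ⟦ m ⟧ * (⟦ suc d ⟧ * fromℚ x)  ≈⟨ *-congˡ (↧*fromℚ x) ⟩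
    ⟦ m ⟧ * fromℤ a                ≤⟨ numerator a le ⟩
    ⟦ suc d ⟧ * ⟦ n ⟧              ∎)
    where
    open ≤-Reasoning
    numerator : ∀ a → a ℤ.* + m ℤ.≤ + n ℤ.* + suc d → ⟦ m ⟧ * fromℤ a ≤ ⟦ suc d ⟧ * ⟦ n ⟧
    numerator (+ k) le = begin
      ⟦ m ⟧ * ⟦ k ⟧       ≈⟨ trans (*-comm _ _) (sym (×1-homo-* k m)) ⟩
      ⟦ k ℕ.* m ⟧
        ≤⟨ ⟦⟧-mono (ℤ.drop‿+≤+ (≡.subst₂ ℤ._≤_ (≡.sym (ℤ.pos-* k m))
            (≡.sym (ℤ.pos-* n (suc d))) le)) ⟩
      ⟦ n ℕ.* suc d ⟧     ≈⟨ trans (×1-homo-* n (suc d)) (*-comm _ _) ⟩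
      ⟦ suc d ⟧ * ⟦ n ⟧   ∎
    numerator -[1+ k ] le = begin
      ⟦ m ⟧ * - ⟦ suc k ⟧ ≤⟨ *-monoʳ-≤ ⟦ m ⟧ 0≤⟦ m ⟧ -≤0 ⟩
      ⟦ m ⟧ * 0#          ≈⟨ zeroʳ ⟦ m ⟧ ⟩
      0#                  ≤⟨ *-nonNeg 0≤⟦ suc d ⟧ 0≤⟦ n ⟧ ⟩
      ⟦ suc d ⟧ * ⟦ n ⟧   ∎
      where
      -≤0 : - ⟦ suc k ⟧ ≤ 0#
      -≤0 = +-cancelˡ-≤ ⟦ suc k ⟧ (begin
        ⟦ suc k ⟧ - ⟦ suc k ⟧ ≈⟨ -‿inverseʳ _ ⟩
        0#                    ≤⟨ 0≤⟦ suc k ⟧ ⟩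
        ⟦ suc k ⟧             ≈⟨ +-identityʳ _ ⟨
        ⟦ suc k ⟧ + 0#        ∎)

  fromℚ-≈ : ∀ x n m → ↥ x ℤ.* + suc m ≡ + n ℤ.* ↧ x → ⟦ suc m ⟧ * fromℚ x ≈ ⟦ n ⟧
  fromℚ-≈ x@(mkℚ -[1+ k ] d _) n m eq = contradiction (≡.trans eq (≡.sym (ℤ.pos-* n (suc d)))) λ ()
  fromℚ-≈ x@(mkℚ (+ k) d _) n m eq = *-cancelˡ-≈ ⟦ suc d ⟧ (proj₂ 0<⟦suc d ⟧ ∘ sym) (begin
    ⟦ suc d ⟧ * (⟦ suc m ⟧ * fromℚ x)
      ≈⟨ solve 3 (λ d m x → d :* (m :* x) := m :* (d :* x)) refl _ _ _ ⟩
    ⟦ suc m ⟧ * (⟦ suc d ⟧ * fromℚ x)  ≈⟨ *-congˡ (↧*fromℚ x) ⟩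
    ⟦ suc m ⟧ * ⟦ k ⟧                  ≈⟨ trans (*-comm _ _) (sym (×1-homo-* k (suc m))) ⟩
    ⟦ k ℕ.* suc m ⟧
      ≈⟨ ⟦⟧-cong (ℤ.+-injective (≡.trans (ℤ.pos-* k (suc m))
          (≡.trans eq (≡.sym (ℤ.pos-* n (suc d)))))) ⟩
    ⟦ n ℕ.* suc d ⟧                    ≈⟨ trans (×1-homo-* n (suc d)) (*-comm _ _) ⟩
    ⟦ suc d ⟧ * ⟦ n ⟧                  ∎)
    where open ≈-Reasoning

  /-≈ : ∀ x n m .⦃ _ : NonZero m ⦄ → x ≡ + n / m → ⟦ m ⟧ * fromℚ x ≈ ⟦ n ⟧
  /-≈ x n (suc m) eq = fromℚ-≈ x n m (≡/⇒*≡* x n (suc m) eq)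

  -- The weight of an edge above `comb g n`: it is 1 only if that comb is a single copy of `g`, so
  -- the spine of the caterpillar has weight 0.
  tip : ℕ → Carrier
  tip zero    = 1#
  tip (suc _) = 0#

  unit : ∀ g n → Edge (comb g n) → Carrier
  unit g zero    _       = 0#
  unit g (suc n) toˡ     = 1#
  unit g (suc n) toʳ     = tip n
  unit g (suc n) (inˡ _) = 0#
  unit g (suc n) (inʳ e) = unit g n e

  0≤tip : ∀ n → 0# ≤ tip n
  0≤tip zero    = 0≤1
  0≤tip (suc _) = ≤-refl

  0≤unit : ∀ g n e → 0# ≤ unit g n e
  0≤unit g zero    _       = ≤-refl
  0≤unit g (suc n) toˡ     = 0≤1
  0≤unit g (suc n) toʳ     = 0≤tip n
  0≤unit g (suc n) (inˡ _) = ≤-refl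
  0≤unit g (suc n) (inʳ e) = 0≤unit g n e

  ⊙0≈0 : ∀ k → k ⊙ 0# ≈ 0#
  ⊙0≈0 0             = refl
  ⊙0≈0 1             = refl
  ⊙0≈0 (suc (suc k)) = ⊙0≈0 k

  ∑ᴱ-zero : ∀ t {f : Edge t → Carrier} → (∀ e → f e ≈ 0#) → ∑ᴱ t f ≈ 0#
  ∑ᴱ-zero leaf       f≈0 = refl
  ∑ᴱ-zero (node l r) f≈0 = trans (+-cong
    (trans (+-cong (f≈0 toˡ) (f≈0 toʳ)) (+-identityʳ 0#))
    (trans (+-cong (∑ᴱ-zero l (f≈0 ∘ inˡ)) (∑ᴱ-zero r (f≈0 ∘ inʳ))) (+-identityʳ 0#)))
        (+-identityʳ 0#)

  -- Counting the edge above the comb as well makes all `suc n` copies contribute 1, including the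
  -- last.
  w[E]-comb : ∀ g n → w[E] (comb g n) (unit g n) + tip n ≈ ⟦ suc n ⟧
  w[E]-comb g zero    = trans (+-comm _ 1#) (+-congˡ (∑ᴱ-zero g (λ _ → refl)))
  w[E]-comb g (suc n) = trans (+-identityʳ _) (trans (+-congˡ (+-congʳ (∑ᴱ-zero g (λ _ → refl))))
    (trans (solve 2 (λ a b → (con 1 :+ a) :+ (con 0 :+ b) := con 1 :+ (b :+ a)) refl (tip n) _)
      (+-congˡ (w[E]-comb g n))))

  -- The weight of the join together with the edge above the comb, if that leads to a copy of g.
  load : ∀ g n → Subset (#leaves (comb g n)) → Carrier
  load g n S = w[J] (comb g n) (unit g n) S + ∣ S ∣ ⊙ tip n

  load-zero : ∀ g S → load g zero S ≈ ∣ S ∣ ⊙ 1#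
  load-zero g S = trans (+-congʳ (∑ᴱ-zero g (λ e → ⊙0≈0 ∣ L g e ∩ S ∣))) (+-identityˡ _)

  load-suc : ∀ g n S T → load g (suc n) (S Vec.++ T) ≈ ∣ S ∣ ⊙ 1# + load g n T
  load-suc g n S T = trans (+-cong (w[J]-node g (comb g n) (unit g (suc n)) S T)
      (⊙0≈0 ∣ S Vec.++ T ∣))
    (trans (+-identityʳ _) (trans (+-congˡ (+-congʳ (∑ᴱ-zero g (λ e → ⊙0≈0 ∣ L g e ∩ S ∣))))
    (solve 3 (λ a b c → (a :+ b) :+ (con 0 :+ c) := a :+ (c :+ b)) refl _ _ _)))

  load-top : ∀ g n S → w[J] (comb g (suc n)) (unit g (suc n)) S ≈ load g (suc n) S
  load-top g n S = sym (trans (+-congˡ (⊙0≈0 ∣ S ∣)) (+-identityʳ _))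

  load-pick : ∀ g X Y → Odd ∣ X ∣ → Even ∣ Y ∣ → ∀ n r → r ℕ.≤ suc n →
    load g n (pick {g} X Y n r) ≈ ⟦ r ⟧
  load-pick g X Y odd even = go
    where
    x≈ : ∣ X ∣ ⊙ 1# ≈ 1#
    x≈ = trans (⊙-congˡ 1# (proj₂ odd)) (odd⊙ (proj₁ odd) 1#)
    y≈ : ∣ Y ∣ ⊙ 1# ≈ 0#
    y≈ = trans (⊙-congˡ 1# (proj₂ even)) (even⊙ (proj₁ even) 1#)
    go : ∀ n r → r ℕ.≤ suc n → load g n (pick {g} X Y n r) ≈ ⟦ r ⟧
    go zero zero _ = trans (load-zero g Y) y≈
    go zero (suc zero) _ = trans (load-zero g X) (trans x≈ (sym ⟦1⟧≈1))
    go zero (suc (suc r)) (s≤s ())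
    go (suc n) zero _ = trans (load-suc g n Y _)
        (trans (+-cong y≈ (go n zero z≤n)) (+-identityʳ 0#))
    go (suc n) (suc r) (s≤s r≤n) = trans (load-suc g n X _) (+-cong x≈ (go n r r≤n))

  ⊙1≤⟦⟧ : ∀ k → k ⊙ 1# ≤ ⟦ k ⟧
  ⊙1≤⟦⟧ 0             = ≤-refl
  ⊙1≤⟦⟧ 1             = ≤-reflexive (sym ⟦1⟧≈1)
  ⊙1≤⟦⟧ (suc (suc k)) = ≤-trans (⊙1≤⟦⟧ k) (⟦⟧-mono (ℕ.m≤n+m k 2))

  -- Each unit edge in the join has a chosen leaf below it, and no leaf lies below two unit edges.
  load≤∣S∣ : ∀ g n S → load g n S ≤ ⟦ ∣ S ∣ ⟧
  load≤∣S∣ g zero S = ≤-trans (≤-reflexive (load-zero g S)) (⊙1≤⟦⟧ ∣ S ∣)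
  load≤∣S∣ g (suc n) S with Vec.splitAt (#leaves g) S
  ... | S₁ , S₂ , ≡.refl = begin
    load g (suc n) (S₁ Vec.++ S₂)   ≈⟨ load-suc g n S₁ S₂ ⟩
    ∣ S₁ ∣ ⊙ 1# + load g n S₂       ≤⟨ +-mono-≤ (⊙1≤⟦⟧ ∣ S₁ ∣) (load≤∣S∣ g n S₂) ⟩
    ⟦ ∣ S₁ ∣ ⟧ + ⟦ ∣ S₂ ∣ ⟧
      ≈⟨ trans (sym (⟦⟧-homo-+ ∣ S₁ ∣ ∣ S₂ ∣)) (⟦⟧-cong (≡.sym (∣++∣ S₁ S₂))) ⟩
    ⟦ ∣ S₁ Vec.++ S₂ ∣ ⟧            ∎
    where open ≤-Reasoning

  ⊙1+⟦⟧≤2 : ∀ k → k ℕ.≤ 2 → k ⊙ 1# + ⟦ k ⟧ ≤ ⟦ 2 ⟧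
  ⊙1+⟦⟧≤2 0 _ = ≤-trans (≤-reflexive (+-identityʳ 0#)) 0≤⟦ 2 ⟧
  ⊙1+⟦⟧≤2 1 _ = ≤-refl
  ⊙1+⟦⟧≤2 2 _ = ≤-reflexive (+-identityˡ ⟦ 2 ⟧)
  ⊙1+⟦⟧≤2 (suc (suc (suc _))) (s≤s (s≤s ()))

  -- A unit edge in the join is above a cherry with one leaf outside `S`, so the load is at most the
  -- number of leaves outside `S`.
  load+∣S∣≤ : ∀ n S → load cherry n S + ⟦ ∣ S ∣ ⟧ ≤ ⟦ suc n ℕ.* 2 ⟧
  load+∣S∣≤ zero S = ≤-trans (≤-reflexive (+-congʳ (load-zero cherry S))) (⊙1+⟦⟧≤2 ∣ S ∣ (∣p∣≤n S))
  load+∣S∣≤ (suc n) S with Vec.splitAt 2 S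
  ... | S₁ , S₂ , ≡.refl = begin
    load cherry (suc n) (S₁ Vec.++ S₂) + ⟦ ∣ S₁ Vec.++ S₂ ∣ ⟧
      ≈⟨ +-cong (load-suc cherry n S₁ S₂) (trans (⟦⟧-cong (∣++∣ S₁ S₂)) (⟦⟧-homo-+ ∣ S₁ ∣ ∣ S₂ ∣)) ⟩
    (∣ S₁ ∣ ⊙ 1# + load cherry n S₂) + (⟦ ∣ S₁ ∣ ⟧ + ⟦ ∣ S₂ ∣ ⟧)
      ≈⟨ solve 4 (λ a b c d → (a :+ b) :+ (c :+ d) := (a :+ c) :+ (b :+ d)) refl _ _ _ _ ⟩
    (∣ S₁ ∣ ⊙ 1# + ⟦ ∣ S₁ ∣ ⟧) + (load cherry n S₂ + ⟦ ∣ S₂ ∣ ⟧)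
      ≤⟨ +-mono-≤ (⊙1+⟦⟧≤2 ∣ S₁ ∣ (∣p∣≤n S₁)) (load+∣S∣≤ n S₂) ⟩
    ⟦ 2 ⟧ + ⟦ suc n ℕ.* 2 ⟧
      ≈⟨ ⟦⟧-homo-+ 2 (suc n ℕ.* 2) ⟨
    ⟦ suc (suc n) ℕ.* 2 ⟧ ∎
    where open ≤-Reasoning

-- The bound with rational `p`, and its tightness.

2≤*2 : ∀ n .⦃ _ : NonZero n ⦄ → 2 ℕ.≤ n ℕ.* 2
2≤*2 (suc n) = s≤s (s≤s z≤n)

≤2/3⇒3a≤2b : ∀ {a b} → + a ℤ.* + 3 ℤ.≤ + 2 ℤ.* + b → a ℕ.* 3 ℕ.≤ 2 ℕ.* b
≤2/3⇒3a≤2b {a} {b} le =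
  ℤ.drop‿+≤+ (≡.subst₂ ℤ._≤_ (≡.sym (ℤ.pos-* a 3)) (≡.sym (ℤ.pos-* 2 b)) le)

2/3≤⇒2b≤3a : ∀ {a b} → + 2 ℤ.* + b ℤ.≤ + a ℤ.* + 3 → 2 ℕ.* b ℕ.≤ a ℕ.* 3
2/3≤⇒2b≤3a {a} {b} le =
  ℤ.drop‿+≤+ (≡.subst₂ ℤ._≤_ (≡.sym (ℤ.pos-* 2 b)) (≡.sym (ℤ.pos-* a 3)) le)

cross : ∀ a b k → + a ℤ.* + (b ℕ.* k) ≡ + (a ℕ.* k) ℤ.* + b
cross a b k = ≡.trans (≡.sym (ℤ.pos-* a (b ℕ.* k))) (≡.trans (≡.cong +_ eq) (ℤ.pos-* (a ℕ.* k) b))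
  where
  eq : a ℕ.* (b ℕ.* k) ≡ a ℕ.* k ℕ.* b
  eq = ≡.trans (≡.cong (a ℕ.*_) (ℕ.*-comm b k)) (≡.sym (ℕ.*-assoc a k b))

module Theorem {c ℓ₁ ℓ₂} (K : OrderedField c ℓ₁ ℓ₂) where
  open OrderedField K hiding (zero)
  open FieldProperties K
  open JoinWeight K
  open LowerBound K
  open Tightness K
  open Weighted K
  open WeightedTree

  weight≈ : ∀ T S → weight T (J? (tree T) S) ≈ w[J] (tree T) (w T) S
  weight≈ T S = w[J]-correct (tree T) (w T) S

  W≈ : ∀ T → W T ≈ w[E] (tree T) (w T)
  W≈ T = w[E]-correct (tree T) (w T)

  bound : (T : WeightedTree) (q : ℕ) → 2 ∣ q → 2 ℕ.≤ q → q ℕ.≤ m T →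
    let p = (+ q / m T) ⦃ #leaves-nonZero (tree T) ⦄ in
    ∃[ S ] ∣ S ∣ ≡ q ×
      fromℚ (p ℚ.⊓ ((+ 2 / 1) ℚ.* (1ℚ ℚ.- p))) * W T ≤ weight T (J? (tree T) S)
  bound T q 2∣q 2≤q q≤m with lower-bound (tree T) (w T) (nonNeg T) q 2∣q 2≤q q≤m
  ... | S , ∣S∣ , few , many = S , ∣S∣ , (begin
    fromℚ z * W T                  ≈⟨ *-congˡ (W≈ T) ⟩
    fromℚ z * w[E] (tree T) (w T)  ≤⟨ *-cancelˡ-≤ ⟦ m T ⟧ 0<m main ⟩
    w[J] (tree T) (w T) S          ≈⟨ weight≈ T S ⟨
    weight T (J? (tree T) S)       ∎)
    where
    open ≤-Reasoning
    instance _ = #leaves-nonZero (tree T)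
    p x z : ℚ
    p = + q / m T
    x = (+ 2 / 1) ℚ.* (1ℚ ℚ.- p)
    z = p ℚ.⊓ x
    W′ = w[E] (tree T) (w T)
    0<m : 0# < ⟦ m T ⟧
    0<m with #leaves≡suc (tree T)
    ... | k , eq = ≡.subst (λ n → 0# < ⟦ n ⟧) (≡.sym eq) 0<⟦suc k ⟧
    via : ∀ n → z ℚ.≤ + n / m T → ⟦ n ⟧ * W′ ≤ ⟦ m T ⟧ * w[J] (tree T) (w T) S →
      ⟦ m T ⟧ * (fromℚ z * W′) ≤ ⟦ m T ⟧ * w[J] (tree T) (w T) S
    via n z≤ n≤ = begin
      ⟦ m T ⟧ * (fromℚ z * W′)  ≈⟨ *-assoc _ _ _ ⟨
      ⟦ m T ⟧ * fromℚ z * W′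
        ≤⟨ *-monoˡ-≤ W′ (∑ᴱ-nonNeg (tree T) (nonNeg T)) (fromℚ-≤ z n (m T) (≤/⇒*≤* z n (m T) z≤)) ⟩
      ⟦ n ⟧ * W′                ≤⟨ n≤ ⟩
      ⟦ m T ⟧ * w[J] (tree T) (w T) S ∎
    main : ⟦ m T ⟧ * (fromℚ z * W′) ≤ ⟦ m T ⟧ * w[J] (tree T) (w T) S
    -- The minimum is at most each of its arguments, so in each range of `q` it suffices to reach
    -- the one that is proved there.
    main with ℕ.≤-total (3 ℕ.* q) (2 ℕ.* m T)
    ... | inj₁ 3q≤2m = via q (ℚ.p⊓q≤p p x) (few 3q≤2m)
    ... | inj₂ 2m≤3q = via (2 ℕ.* (m T ℕ.∸ q))
      (ℚ.≤-trans (ℚ.p⊓q≤q p x) (ℚ.≤-reflexive (2*[1-q/m]≡ q (m T) q≤m))) (many 3r≤m)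
      where
      -- `3m - 3q ≤ 3m - 2m`.
      3r≤m : 3 ℕ.* (m T ℕ.∸ q) ℕ.≤ m T
      3r≤m = ℕ.≤-trans (ℕ.≤-reflexive (ℕ.*-distribˡ-∸ 3 (m T) q))
        (ℕ.≤-trans (ℕ.∸-monoʳ-≤ (3 ℕ.* m T) 2m≤3q) (ℕ.≤-reflexive (ℕ.m+n∸n≡m (m T) (2 ℕ.* m T))))

  combTree : Tree → ℕ → WeightedTree
  combTree g n = record { tree = comb g n ; w = unit g n ; nonNeg = 0≤unit g n }

  W-comb : ∀ g n → W (combTree g (suc n)) ≈ ⟦ suc (suc n) ⟧
  W-comb g n = trans (W≈ (combTree g (suc n))) (trans (sym (+-identityʳ _)) (w[E]-comb g (suc n)))

  0<W-comb : ∀ g n → 0# < W (combTree g (suc n))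
  0<W-comb g n = ≤-trans (proj₁ 0<⟦suc suc n ⟧) (≤-reflexive (sym (W-comb g n))) ,
    λ 0≈W → proj₂ 0<⟦suc suc n ⟧ (trans 0≈W (W-comb g n))

  -- The maximum is attained by `pick`. The bound `upper` is a hypothesis because it has different
  -- reasons for leaves and for cherries.
  max-comb : ∀ g n q r (X Y : Subset (#leaves g)) → Odd ∣ X ∣ → Even ∣ Y ∣ → r ℕ.≤ 2 ℕ.+ n →
    r ℕ.* ∣ X ∣ ℕ.+ (2 ℕ.+ n ℕ.∸ r) ℕ.* ∣ Y ∣ ≡ q →
    (∀ S → ∣ S ∣ ≡ q → load g (suc n) S ≤ ⟦ r ⟧) →
    ∀ x → x ≈ ⟦ r ⟧ → MaxJWeight (combTree g (suc n)) q x
  max-comb g n q r X Y odd even r≤ ∣pick∣≡q upper x x≈ =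
    (pick {g} X Y (suc n) r , ≡.trans (∣pick∣ {g} X Y (suc n) r r≤) ∣pick∣≡q ,
      trans (weight≈load _) (trans (load-pick g X Y odd even (suc n) r r≤) (sym x≈))) ,
    λ S ∣S∣ → ≤-trans (≤-reflexive (weight≈load S)) (≤-trans (upper S ∣S∣) (≤-reflexive (sym x≈)))
    where
    weight≈load : ∀ S → weight (combTree g (suc n)) (J? (comb g (suc n)) S) ≈ load g (suc n) S
    weight≈load S = trans (weight≈ (combTree g (suc n)) S) (load-top g n S)

  tight-few : (p : ℚ) → 0ℚ ℚ.< p → p ℚ.≤ + 2 / 3 →
    ∃[ T ] 0# < W T × ∃[ q ]
      2 ∣ q × 2 ℕ.≤ q × q ℕ.≤ m T ×
      (+ q / m T) ⦃ #leaves-nonZero (tree T) ⦄ ≡ p ×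
      MaxJWeight T q (fromℚ p * W T)
  tight-few (mkℚ -[1+ _ ] _ _) (*<* ()) _
  tight-few (mkℚ (+ 0) _ _) (*<* (ℤ.+<+ ())) _
  tight-few p@(mkℚ (+ a@(suc _)) b′ _) _ (*≤* le) =
    T , 0<W-comb leaf (b′ ℕ.* 2) , q , divides a ≡.refl , 2≤*2 a ,
    ≡.subst (q ℕ.≤_) (≡.sym #T) q≤2b , q/m≡p ,
    max-comb leaf (b′ ℕ.* 2) q q ⊤ ⊥ (0 , ≡.refl) (0 , ≡.refl) q≤2b
      (≡.trans (≡.cong₂ ℕ._+_ (ℕ.*-identityʳ q) (ℕ.*-zeroʳ (b ℕ.* 2 ℕ.∸ q))) (ℕ.+-identityʳ q))
      (λ S ∣S∣ → ≤-trans (load≤∣S∣ leaf (suc (b′ ℕ.* 2)) S) (≤-reflexive (⟦⟧-cong ∣S∣)))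
      (fromℚ p * W T)
      (trans (*-congˡ (W-comb leaf (b′ ℕ.* 2))) (trans (*-comm _ _)
        (fromℚ-≈ p q (suc (b′ ℕ.* 2)) (cross a b 2))))
    where
    b = suc b′
    -- For `p = a/b`, doubling makes `q` even and gives the tree `2b ≥ 2` leaves, hence edges.
    q = a ℕ.* 2
    T = combTree leaf (suc (b′ ℕ.* 2))
    #T : m T ≡ b ℕ.* 2
    #T = ≡.trans (#leaves-comb leaf (suc (b′ ℕ.* 2))) (ℕ.*-identityʳ _)
    a≤b : a ℕ.≤ b
    a≤b = ℕ.*-cancelˡ-≤ 2 (ℕ.≤-trans (ℕ.≤-trans (ℕ.*-monoˡ-≤ a (ℕ.n≤1+n 2))
        (ℕ.≤-reflexive (ℕ.*-comm 3 a)))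
      (≤2/3⇒3a≤2b {a} {b} le))
    q≤2b : q ℕ.≤ b ℕ.* 2
    q≤2b = ℕ.*-monoˡ-≤ 2 a≤b
    q/m≡p : (+ q / m T) ⦃ #leaves-nonZero (tree T) ⦄ ≡ p
    q/m≡p = /≡ q (m T) ⦃ #leaves-nonZero (tree T) ⦄ p
      (≡.trans (≡.cong (λ n → + a ℤ.* + n) #T) (cross a b 2))

  tight-many : (p : ℚ) → + 2 / 3 ℚ.≤ p → p ℚ.≤ 1ℚ →
    ∃[ T ] 0# < W T × ∃[ q ]
      2 ∣ q × 2 ℕ.≤ q × q ℕ.≤ m T ×
      (+ q / m T) ⦃ #leaves-nonZero (tree T) ⦄ ≡ p ×
      MaxJWeight T q (fromℚ ((+ 2 / 1) ℚ.* (1ℚ ℚ.- p)) * W T)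
  tight-many (mkℚ -[1+ _ ] _ _) (*≤* ()) _
  tight-many (mkℚ (+ 0) _ _) (*≤* (+≤+ ())) _
  tight-many p@(mkℚ (+ a@(suc a′)) b′ _) (*≤* ge) (*≤* le) =
    T , 0<W-comb cherry (b′ ℕ.* 2) , q , divides (a ℕ.* 2) (≡.sym (ℕ.*-assoc a 2 2)) ,
    s≤s (s≤s z≤n) , q≤m , q/m≡p ,
    max-comb cherry (b′ ℕ.* 2) q r (⊤ {1} Vec.++ ⊥ {1}) ⊤ (0 , ≡.refl) (1 , ≡.refl) r≤2b size upper
      (fromℚ x * W T) value
    where
    open ≤-Reasoning
    b = suc b′
    -- For `p = a/b` there are `2b` cherries with `4b` leaves. The `r = 4(b - a)` leaves outside the
    -- optimal set lie in different cherries, each of which contributes 1; this equals `2(1 - p)`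
    -- times the total weight `2b`.
    q = a ℕ.* 4
    d = b ℕ.∸ a
    r = d ℕ.* 4
    T = combTree cherry (suc (b′ ℕ.* 2))
    x = (+ 2 / 1) ℚ.* (1ℚ ℚ.- p)
    #T : m T ≡ b ℕ.* 4
    #T = ≡.trans (#leaves-comb cherry (suc (b′ ℕ.* 2))) (ℕ.*-assoc b 2 2)
    a≤b : a ℕ.≤ b
    a≤b = ℤ.drop‿+≤+ (≡.subst₂ ℤ._≤_ (ℤ.*-identityʳ (+ a)) (ℤ.*-identityˡ (+ b)) le)
    a+d≡b : a ℕ.+ d ≡ b
    a+d≡b = ℕ.m+[n∸m]≡n a≤b
    q+r≡4b : q ℕ.+ r ≡ b ℕ.* 4
    q+r≡4b = ≡.trans (≡.sym (ℕ.*-distribʳ-+ 4 a d)) (≡.cong (ℕ._* 4) a+d≡b)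
    q≤m : q ℕ.≤ m T
    q≤m = ≡.subst (q ℕ.≤_) (≡.trans q+r≡4b (≡.sym #T)) (ℕ.m≤m+n q r)
    m∸q≡r : m T ℕ.∸ q ≡ r
    m∸q≡r = ≡.trans (≡.cong (ℕ._∸ q) (≡.trans #T (≡.sym q+r≡4b))) (ℕ.m+n∸m≡n q r)
    -- From `2a + 2d = 2b ≤ 3a`, even `2d ≤ a` follows. Here `d ≤ a` serves to show that there are
    -- enough cherries for the `r` missing leaves.
    d≤a : d ℕ.≤ a
    d≤a = ℕ.≤-trans (ℕ.m≤m+n d (d ℕ.+ 0)) (ℕ.+-cancelˡ-≤ (2 ℕ.* a) _ _ (ℕ.≤-trans
      (ℕ.≤-reflexive (≡.trans (≡.sym (ℕ.*-distribˡ-+ 2 a d)) (≡.cong (2 ℕ.*_) a+d≡b)))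
      (ℕ.≤-trans (2/3≤⇒2b≤3a {a} {b} ge)
          (ℕ.≤-reflexive (≡.trans (ℕ.*-comm a 3) (ℕ.+-comm a (2 ℕ.* a)))))))
    d*2≤b : d ℕ.* 2 ℕ.≤ b
    d*2≤b = ℕ.≤-trans (ℕ.≤-reflexive (≡.trans (ℕ.*-comm d 2) (≡.cong (d ℕ.+_) (ℕ.+-identityʳ d))))
      (ℕ.≤-trans (ℕ.+-monoˡ-≤ d d≤a) (ℕ.≤-reflexive a+d≡b))
    r≤2b : r ℕ.≤ b ℕ.* 2
    r≤2b = ℕ.≤-trans (ℕ.≤-reflexive (≡.sym (ℕ.*-assoc d 2 2))) (ℕ.*-monoˡ-≤ 2 d*2≤b)
    size : r ℕ.* 1 ℕ.+ (b ℕ.* 2 ℕ.∸ r) ℕ.* 2 ≡ q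
    size = ℕ.+-cancelˡ-≡ r _ _ (≡.trans (≡.trans
        (≡.cong (λ n → r ℕ.+ (n ℕ.+ s ℕ.* 2)) (ℕ.*-identityʳ r))
      (≡.trans (≡.sym (ℕ.+-assoc r r (s ℕ.* 2)))
      (≡.trans (≡.cong (ℕ._+ s ℕ.* 2) (≡.trans (≡.cong (r ℕ.+_) (≡.sym (ℕ.+-identityʳ r)))
          (ℕ.*-comm 2 r)))
      (≡.trans (≡.sym (ℕ.*-distribʳ-+ 2 r s))
          (≡.trans (≡.cong (ℕ._* 2) (ℕ.m+[n∸m]≡n r≤2b)) (ℕ.*-assoc b 2 2))))))
      (≡.trans (≡.sym q+r≡4b) (ℕ.+-comm q r)))
      where s = b ℕ.* 2 ℕ.∸ r
    q/m≡p : (+ q / m T) ⦃ #leaves-nonZero (tree T) ⦄ ≡ p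
    q/m≡p = /≡ q (m T) ⦃ #leaves-nonZero (tree T) ⦄ p
      (≡.trans (≡.cong (λ n → + a ℤ.* + n) #T) (cross a b 4))
    upper : ∀ S → ∣ S ∣ ≡ q → load cherry (suc (b′ ℕ.* 2)) S ≤ ⟦ r ⟧
    upper S ∣S∣ = +-cancelˡ-≤ ⟦ q ⟧ (begin
      ⟦ q ⟧ + load cherry (suc (b′ ℕ.* 2)) S
        ≈⟨ trans (+-comm _ _) (+-congˡ (⟦⟧-cong (≡.sym ∣S∣))) ⟩
      load cherry (suc (b′ ℕ.* 2)) S + ⟦ ∣ S ∣ ⟧  ≤⟨ load+∣S∣≤ (suc (b′ ℕ.* 2)) S ⟩
      ⟦ b ℕ.* 2 ℕ.* 2 ⟧  ≈⟨ ⟦⟧-cong (≡.trans (ℕ.*-assoc b 2 2) (≡.sym q+r≡4b)) ⟩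
      ⟦ q ℕ.+ r ⟧        ≈⟨ ⟦⟧-homo-+ q r ⟩
      ⟦ q ⟧ + ⟦ r ⟧      ∎)
    x≡ : x ≡ (+ (2 ℕ.* r) / m T) ⦃ #leaves-nonZero (tree T) ⦄
    x≡ = ≡.trans (≡.cong (λ p → (+ 2 / 1) ℚ.* (1ℚ ℚ.- p)) (≡.sym q/m≡p))
      (≡.trans (2*[1-q/m]≡ q (m T) ⦃ #leaves-nonZero (tree T) ⦄ q≤m)
        (≡.cong (λ n → (+ (2 ℕ.* n) / m T) ⦃ #leaves-nonZero (tree T) ⦄) m∸q≡r))
    value : fromℚ x * W T ≈ ⟦ r ⟧
    -- The number of leaves is twice the total weight, and `x` is `2r` divided by the number of
    -- leaves; hence the factor 2 to cancel.
    value = trans (*-congˡ (W-comb cherry (b′ ℕ.* 2))) (*-cancelˡ-≈ ⟦ 2 ⟧ (proj₂ 0<⟦suc 1 ⟧ ∘ sym)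
      (trans (solve 3 (λ k x w → k :* (x :* w) := w :* k :* x) refl ⟦ 2 ⟧ (fromℚ x) ⟦ b ℕ.* 2 ⟧)
      (trans (*-congʳ (trans (sym (×1-homo-* (b ℕ.* 2) 2))
          (⟦⟧-cong (≡.trans (ℕ.*-assoc b 2 2) (≡.sym #T)))))
      (trans (/-≈ x (2 ℕ.* r) (m T) ⦃ #leaves-nonZero (tree T) ⦄ x≡) (×1-homo-* 2 r)))))

theorem2 : ∀ {c ℓ₁ ℓ₂} (K : OrderedField c ℓ₁ ℓ₂) →
  let open OrderedField K
      open Weighted K
      open WeightedTree
  in
    ((T : WeightedTree) (q : ℕ) → 2 ∣ q → 2 ℕ.≤ q → q ℕ.≤ m T →
      let p = (+ q / m T) ⦃ #leaves-nonZero (tree T) ⦄ in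
      ∃[ S ] ∣ S ∣ ≡ q ×
        fromℚ (p ℚ.⊓ ((+ 2 / 1) ℚ.* (1ℚ ℚ.- p))) * W T ≤ weight T (J? (tree T) S))
    ×
    ((p : ℚ) → 0ℚ ℚ.< p → p ℚ.≤ + 2 / 3 →
      ∃[ T ] 0# < W T × ∃[ q ]
        2 ∣ q × 2 ℕ.≤ q × q ℕ.≤ m T ×
        (+ q / m T) ⦃ #leaves-nonZero (tree T) ⦄ ≡ p ×
        MaxJWeight T q (fromℚ p * W T))
    ×
    ((p : ℚ) → + 2 / 3 ℚ.≤ p → p ℚ.≤ 1ℚ →
      ∃[ T ] 0# < W T × ∃[ q ]
        2 ∣ q × 2 ℕ.≤ q × q ℕ.≤ m T ×
        (+ q / m T) ⦃ #leaves-nonZero (tree T) ⦄ ≡ p ×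
        MaxJWeight T q (fromℚ ((+ 2 / 1) ℚ.* (1ℚ ℚ.- p)) * W T))
theorem2 K = bound , tight-few , tight-many
  where open Theorem K
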